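{- Let $k\equiv 3\pmod 4$ and $n\ge 2$, and let $c\colon SG_{n,k}\to K_{k+2}$ be the canonical colouring. Then for every automorphism $\gamma\in\mathrm{Aut}(SG_{n,k})$ there is a path in $\mathrm{Hom}(SG_{n,k},K_{k+2})$ from $c$ to $c\circ\gamma$.
   Context: For $n\ge1$, $k\ge0$, $m=2n+k$: a subset $S\subseteq\{0,\dots,m-1\}$ is stable if $\{i,i+1\}\not\subseteq S$ for all $0\le i\le m-2$ and $\{0,m-1\}\not\subseteq S$. The stable Kneser graph $SG_{n,k}$ has as vertices the stable $n$-element subsets of $\{0,\dots,m-1\}$, two being adjacent iff they are disjoint. $K_{k+2}$ is the complete graph on vertex set $\{0,\dots,k+1\}$. The canonical colouring is $c(S)=\min S$, a graph homomorphism $SG_{n,k}\to K_{k+2}$. For graphs $T,G$, $\mathrm{Hom}(T,G)$ is a cell complex whose vertices are the graph homomorphisms $T\to G$, two being joined by an edge exactly when they differ at exactly one vertex of $T$; a path means a path in this 1-skeleton. -}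

module Defs where

open import Data.Nat using (ℕ; s≤s; z≤n; zero; suc; _+_; _*_; _<_; _≡ᵇ_; _<?_)
open import Data.Bool using (Bool; true; false; _∧_; not; T; if_then_else_)
open import Data.Vec using (Vec; []; _∷_)
open import Data.Fin using (Fin; fromℕ<) renaming (zero to fzero)
open import Data.Product using (Σ; ∃; _×_; proj₁; _,_)
open import Relation.Binary.PropositionalEquality using (_≡_; _≢_)
open import Relation.Nullary using (yes; no)
open import Data.Nat.Properties using (m≤n+m; ≤-trans)

-- Subsets of {0,…,m-1} are characteristic vectors: position i is true iff i ∈ S.

noAdj : ∀ {m} → Vec Bool m → Bool
noAdj [] = true
noAdj (x ∷ []) = true
noAdj (x ∷ y ∷ xs) = not (x ∧ y) ∧ noAdj (y ∷ xs)

lastB : ∀ {m} → Bool → Vec Bool m → Bool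
lastB x [] = x
lastB x (y ∷ ys) = lastB y ys

noWrap : ∀ {m} → Vec Bool m → Bool
noWrap [] = true
noWrap (x ∷ xs) = not (x ∧ lastB x xs)

stableB : ∀ {m} → Vec Bool m → Bool
stableB S = noAdj S ∧ noWrap S

card : ∀ {m} → Vec Bool m → ℕ
card [] = 0
card (true ∷ xs) = suc (card xs)
card (false ∷ xs) = card xs

disjointB : ∀ {m} → Vec Bool m → Vec Bool m → Bool
disjointB [] [] = true
disjointB (x ∷ xs) (y ∷ ys) = not (x ∧ y) ∧ disjointB xs ys

-- vertices of SG_{n,k}: stable n-subsets of {0,…,2n+k-1}
-- (the property is a T of a boolean, hence proof-irrelevant, so ≡ on
--  vertices is equality of the underlying subsets)
SGVertex : ℕ → ℕ → Set
SGVertex n k = Σ (Vec Bool (2 * n + k)) (λ S → T (stableB S ∧ (card S ≡ᵇ n)))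

SGAdj : ∀ {n k} → SGVertex n k → SGVertex n k → Set
SGAdj u v = T (disjointB (proj₁ u) (proj₁ v))

-- index of the least element of S (m if S is empty)
minIdx : ∀ {m} → Vec Bool m → ℕ
minIdx [] = 0
minIdx (true ∷ xs) = 0
minIdx (false ∷ xs) = suc (minIdx xs)

-- canonical colouring c(S) = min S, as a colour in {0,…,k+1} = Fin (k+2).
-- For every vertex min S ≤ k+1, so the fallback branch is never used.
canonical : ∀ {n k} → SGVertex n k → Fin (k + 2)
canonical {n} {k} v with minIdx (proj₁ v) <? k + 2
... | yes p = fromℕ< p
... | no _ = fromℕ< {0} (≤-trans (s≤s z≤n) (m≤n+m 2 k))

IsHom : ∀ {n k} → (SGVertex n k → Fin (k + 2)) → Set
IsHom f = ∀ u v → SGAdj u v → f u ≢ f v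

DifferAtOne : ∀ {n k} → (f g : SGVertex n k → Fin (k + 2)) → Set
DifferAtOne {n} {k} f g =
  Σ (SGVertex n k) (λ v → (f v ≢ g v) × (∀ w → w ≢ v → f w ≡ g w))

-- paths in the 1-skeleton of Hom(SG_{n,k}, K_{k+2}); every vertex on the
-- path is a homomorphism, consecutive ones differ at exactly one vertex.
-- The endpoint is matched pointwise (functions are not compared with ≡).
data HomPath {n k : ℕ} : (SGVertex n k → Fin (k + 2)) → (SGVertex n k → Fin (k + 2)) → Set where
  done : ∀ {f g} → IsHom f → (∀ v → f v ≡ g v) → HomPath f g
  step : ∀ {f g h} → IsHom f → DifferAtOne f g → HomPath g h → HomPath f h

record Automorphism (n k : ℕ) : Set where
  field
    fun : SGVertex n k → SGVertex n k
    inv : SGVertex n k → SGVertex n k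
    inv-fun : ∀ v → inv (fun v) ≡ v
    fun-inv : ∀ v → fun (inv v) ≡ v
    adj-pres : ∀ u v → SGAdj u v → SGAdj (fun u) (fun v)
    adj-refl : ∀ u v → SGAdj (fun u) (fun v) → SGAdj u v

{-# OPTIONS --safe #-}

-- If f ≤ g are proper colourings, then recolouring from f to g in decreasing order of the new
-- colour stays proper, so there is a path from f to g.  With the rotation ρ and the reflection τ
-- of the cycle this joins c to prev ∘ c ∘ ρ and to opposite ∘ c ∘ τ, where prev and opposite are
-- a (k+2)-cycle and the reversal of the colours.  Restricted to the sets with minimum ≥ k − 1,
-- c is a 3-colouring of essentially an odd cycle of length 2n + 1 ≥ 5, which can be rotated; so
-- c is joined to κ ∘ c for the 3-cycle κ of the top three colours.  Conjugating κ by prev (through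
-- ρ) yields all 3-cycles of consecutive colours, hence all even permutations of the colours, and
-- both prev and opposite are even because k ≡ 3 mod 4.
--
-- It remains to see that every automorphism γ is dihedral.  Comparing common neighbourhoods
-- characterises the relation "u arises from s by moving one element by one position" in terms of
-- adjacency, so γ preserves it.  The vertices with only two such moves are the rotations of
-- {0, 2, …, 2n − 2}, so γ fixes this vertex and its two moves up to dihedral symmetry; and an
-- automorphism fixing a vertex and all of its moves does the same at each of these moves.
module Submission where

open import Defs
open import Data.Nat using (ℕ; zero; suc; _+_; _*_; _%_; _≤_; _≡ᵇ_; _≤ᵇ_; _<?_; s≤s; z≤n)
import Data.Nat as ℕ
import Data.Nat.Properties as ℕ
open import Data.Nat.DivMod using (m≡m%n+[m/n]*n)
open import Data.Nat.Induction using (<-wellFounded)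
open import Data.Nat.Solver using (module +-*-Solver)
open import Induction.WellFounded using (Acc; acc)
open import Data.Bool using (Bool; true; false; _∧_; _xor_; not; T; if_then_else_)
import Data.Bool.Properties as Bool
open import Data.Fin using (Fin; zero; suc; toℕ; fromℕ; inject₁; opposite)
import Data.Fin as Fin
import Data.Fin.Properties as Fin
open import Data.Fin.Patterns using (0F; 1F; 2F; 3F; 4F; 5F)
open import Data.Fin.Permutation using (permutation)
open import Data.Fin.Relation.Unary.Top using (view; ‵fromℕ; ‵inject₁; view-fromℕ; view-inject₁)
open import Algebra.Properties.CommutativeMonoid.Sum ℕ.+-0-commutativeMonoid using (sum; sum-permute; sum-cong-≗; ∑-distrib-+)
open import Data.Vec using (Vec; []; _∷_; lookup; tabulate; _[_]≔_)
import Data.Vec as Vec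
open import Data.Vec.Properties using (≡-dec; lookup∘tabulate; tabulate∘lookup; tabulate-cong; lookup∘updateAt; lookup∘updateAt′)
open import Data.List using (List; []; _∷_; map; _++_)
open import Data.List.Membership.Propositional using (lose) renaming (_∈_ to _∈ˡ_)
open import Data.List.Membership.Propositional.Properties using (∈-map⁺; ∈-++⁺ˡ; ∈-++⁺ʳ)
open import Data.List.Relation.Unary.All as All using (All; []; _∷_)
import Data.List.Relation.Unary.All.Properties as All
open import Data.List.Relation.Unary.Any as Any using (here; there)
open import Data.List.Relation.Unary.Any.Properties using (lookup-result)
open import Data.Product using (∃; _×_; proj₁; proj₂; _,_)
open import Data.Sum using (_⊎_; inj₁; inj₂)
open import Data.Empty using (⊥; ⊥-elim)
open import Function using (_∘_)
open import Relation.Binary using (tri<; tri≈; tri>)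
open import Relation.Binary.PropositionalEquality
open import Relation.Nullary using (yes; no; ¬_; Dec; ¬?; _×-dec_; _⊎-dec_; _→-dec_)
open import Relation.Nullary.Decidable using (decidable-stable; map′; toWitness)

open +-*-Solver using (solve; _:+_; _:*_; _:=_; con)

-- Paths of colourings

private variable
  n k ℓ m : ℕ

-- Being joined by a path is stable under an injective recolouring on one side and an automorphism
-- on the other, so generators suffice; and if a dihedral `δ` undoes `γ`, precomposing a path from
-- `c` to `c ∘ δ` with `γ` gives the required path backwards. All nontrivial paths rest on one
-- principle: if `f` and `g` are proper and `f u ≢ g v` for all adjacent `u`, `v`, the vertices can
-- be switched from `f` to `g` in any order. The residue of k enters twice. As k is odd, so is m,
-- and this leaves only one vertex in which no element but 0 can move left. And `prev` is a cycle of
-- odd length k + 2, while `opposite` consists of (k + 1)/2 transpositions, an even number. The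
-- hypothesis n ≥ 2 also enters twice: a 3-coloured cycle of length 3 is frozen while length 5
-- leaves room to rotate, and recognising a move by one position needs a second element that could
-- be exchanged instead.

∧-split : ∀ a {b} → T (a ∧ b) → T a × T b
∧-split true p = _ , p

∧-pair : ∀ {a b} → T a → T b → T (a ∧ b)
∧-pair {true} _ q = q

Coloring : ℕ → ℕ → Set
Coloring n k = SGVertex n k → Fin (k + 2)

vertex-≡ : {u v : SGVertex n k} → proj₁ u ≡ proj₁ v → u ≡ v
vertex-≡ {u = S , p} {v = .S , q} refl = cong (S ,_) (Bool.T-irrelevant p q)

_≟V_ : (S S′ : Vec Bool n) → Relation.Nullary.Dec (S ≡ S′)
_≟V_ = ≡-dec Bool._≟_

disjointB-sym : ∀ {m} (S S′ : Vec Bool m) → T (disjointB S S′) → T (disjointB S′ S)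
disjointB-sym [] [] p = p
disjointB-sym (x ∷ S) (y ∷ S′) p with ∧-split (not (x ∧ y)) p
... | q , r = ∧-pair (subst (T ∘ not) (Bool.∧-comm x y) q) (disjointB-sym S S′ r)

adj-sym : (u v : SGVertex n k) → SGAdj u v → SGAdj v u
adj-sym u v = disjointB-sym (proj₁ u) (proj₁ v)

IsHom-resp-≗ : {f g : Coloring n k} → f ≗ g → IsHom f → IsHom g
IsHom-resp-≗ e h u v a p = h u v a (trans (e u) (trans p (sym (e v))))

path-source : {f g : Coloring n k} → HomPath f g → IsHom f
path-source (done h _) = h
path-source (step h _ _) = h

path-target : {f g : Coloring n k} → HomPath f g → IsHom g
path-target (done h e) = IsHom-resp-≗ e h
path-target (step _ _ p) = path-target p

path-respˡ : {f f′ g : Coloring n k} → f′ ≗ f → HomPath f g → HomPath f′ g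
path-respˡ e (done h e′) = done (IsHom-resp-≗ (sym ∘ e) h) (λ v → trans (e v) (e′ v))
path-respˡ e (step h (v , ne , same) p) =
  step (IsHom-resp-≗ (sym ∘ e) h)
       (v , (λ q → ne (trans (sym (e v)) q)) , λ w w≢v → trans (e w) (same w w≢v)) p

path-trans : {f g h : Coloring n k} → HomPath f g → HomPath g h → HomPath f h
path-trans (done _ e) q = path-respˡ e q
path-trans (step h d p) q = step h d (path-trans p q)

path-respʳ : {f g g′ : Coloring n k} → g ≗ g′ → HomPath f g → HomPath f g′
path-respʳ e p = path-trans p (done (path-target p) e)

path-sym : {f g : Coloring n k} → HomPath f g → HomPath g f
path-sym (done h e) = done (IsHom-resp-≗ e h) (sym ∘ e)
path-sym (step h (v , ne , same) p) =
  path-trans (path-sym p)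
    (step (path-source p) (v , ne ∘ sym , λ w w≢v → sym (same w w≢v)) (done h λ _ → refl))

path-recolor : {f g : Coloring n k} (π : Fin (k + 2) → Fin (k + 2)) →
  (∀ {x y} → π x ≡ π y → x ≡ y) → HomPath f g → HomPath (π ∘ f) (π ∘ g)
path-recolor π inj (done h e) = done (λ u v a p → h u v a (inj p)) (λ v → cong π (e v))
path-recolor π inj (step h (v , ne , same) p) =
  step (λ u v a p → h u v a (inj p)) (v , ne ∘ inj , λ w w≢v → cong π (same w w≢v))
       (path-recolor π inj p)

path-precompose : {f g : Coloring n k} (γ : Automorphism n k) → let open Automorphism γ in
  HomPath f g → HomPath (f ∘ fun) (g ∘ fun)
path-precompose γ (done h e) = done (λ u v a → h _ _ (adj-pres u v a)) (λ v → e _)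
  where open Automorphism γ
path-precompose {f = f} γ (step {g = g} h (v , ne , same) p) =
  step (λ u v a → h _ _ (adj-pres u v a))
       (inv v , subst (λ w → f w ≢ g w) (sym (fun-inv v)) ne ,
        λ w w≢ → same (fun w) (λ q → w≢ (trans (sym (inv-fun w)) (cong inv q))))
       (path-precompose γ p)
  where open Automorphism γ

allSubsets : ∀ m → List (Vec Bool m)
allSubsets zero = [] ∷ []
allSubsets (suc m) = map (true ∷_) (allSubsets m) ++ map (false ∷_) (allSubsets m)

∈-allSubsets : ∀ {m} (S : Vec Bool m) → S ∈ˡ allSubsets m
∈-allSubsets [] = here refl
∈-allSubsets (true ∷ S) = ∈-++⁺ˡ (∈-map⁺ (true ∷_) (∈-allSubsets S))
∈-allSubsets (false ∷ S) =
  ∈-++⁺ʳ (map (true ∷_) (allSubsets _)) (∈-map⁺ (false ∷_) (∈-allSubsets S))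

-- `S` need not be a vertex, and the two colours at `S` may already agree; in both cases the path is
-- trivial. So the switching can run over `allSubsets` without an enumeration of the vertices.
path-single : {f g : Coloring n k} (S : Vec Bool _) → IsHom f → IsHom g →
  (∀ w → proj₁ w ≢ S → f w ≡ g w) → HomPath f g
path-single {n} {k} {f} {g} S hf hg same
  with Bool.T? (stableB S ∧ (card S ≡ᵇ n))
... | no ¬p = done hf λ w → same w λ e → ¬p (subst (λ S → T (stableB S ∧ (card S ≡ᵇ n))) e (proj₂ w))
... | yes p with f (S , p) Fin.≟ g (S , p)
...   | no ne = step hf ((S , p) , ne , λ w w≢ → same w (w≢ ∘ vertex-≡)) (done hg λ _ → refl)
...   | yes eq = done hf agree
  where
  agree : f ≗ g
  agree w with proj₁ w ≟V S
  ... | yes e = subst (λ v → f v ≡ g v) (sym (vertex-≡ {u = w} {v = S , p} e)) eq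
  ... | no ne = same w ne

-- An edge between a switched and an unswitched vertex is proper by `fg`, read in one of its two
-- directions; hence every mixture of `f` and `g` is a homomorphism.
module Switching {f g : Coloring n k} (hf : IsHom f) (hg : IsHom g)
  (fg : ∀ u v → SGAdj u v → f u ≢ g v) where

  switch : List (Vec Bool (2 * n + k)) → Coloring n k
  switch [] v = f v
  switch (S ∷ L) v with proj₁ v ≟V S
  ... | yes _ = g v
  ... | no _ = switch L v

  switch-either : ∀ L v → switch L v ≡ f v ⊎ switch L v ≡ g v
  switch-either [] v = inj₁ refl
  switch-either (S ∷ L) v with proj₁ v ≟V S
  ... | yes _ = inj₂ refl
  ... | no _ = switch-either L v

  switch-hom : ∀ L → IsHom (switch L)
  switch-hom L u v a e with switch-either L u | switch-either L v
  ... | inj₁ p | inj₁ q = hf u v a (trans (sym p) (trans e q))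
  ... | inj₁ p | inj₂ q = fg u v a (trans (sym p) (trans e q))
  ... | inj₂ p | inj₁ q = fg v u (adj-sym u v a) (trans (sym q) (trans (sym e) p))
  ... | inj₂ p | inj₂ q = hg u v a (trans (sym p) (trans e q))

  switch-same : ∀ S L w → proj₁ w ≢ S → switch L w ≡ switch (S ∷ L) w
  switch-same S L w ne with proj₁ w ≟V S
  ... | yes e = ⊥-elim (ne e)
  ... | no _ = refl

  switch-path : ∀ L → HomPath f (switch L)
  switch-path [] = done hf λ _ → refl
  switch-path (S ∷ L) = path-trans (switch-path L)
    (path-single S (switch-hom L) (switch-hom (S ∷ L)) (switch-same S L))

  switch-∈ : ∀ L v → proj₁ v ∈ˡ L → switch L v ≡ g v
  switch-∈ (S ∷ L) v i with proj₁ v ≟V S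
  ... | yes _ = refl
  ... | no ne with i
  ...   | here e = ⊥-elim (ne e)
  ...   | there j = switch-∈ L v j

  switching-path : HomPath f g
  switching-path = path-respʳ (λ v → switch-∈ (allSubsets _) v (∈-allSubsets (proj₁ v)))
                              (switch-path (allSubsets _))

open Switching using (switching-path)

-- The colourings "g where g ≥ t, f elsewhere" interpolate between f and g.  They are proper
-- because an unswitched v with the colour of a switched u would have f v = g u ≥ t > g v.
module Threshold {f g : Coloring n k} (hf : IsHom f) (hg : IsHom g)
  (f≤g : ∀ v → f v Fin.≤ g v) where

  above : ℕ → Coloring n k
  above t v with t ℕ.≤? toℕ (g v)
  ... | yes _ = g v
  ... | no _ = f v

  -- The case `s = t` says that `above t` is proper; the case `s = suc t` permits the switch between
  -- consecutive thresholds.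
  above-compatible : ∀ t s → t ℕ.≤ s → s ℕ.≤ suc t → ∀ u v → SGAdj u v → above s u ≢ above t v
  above-compatible t s t≤s s≤1+t u v a e with s ℕ.≤? toℕ (g u) | t ℕ.≤? toℕ (g v)
  ... | yes p | yes q = hg u v a e
  ... | yes p | no q =
    q (ℕ.≤-trans t≤s (ℕ.≤-trans p (ℕ.≤-trans (ℕ.≤-reflexive (cong toℕ e)) (f≤g v))))
  ... | no p | no q = hf u v a e
  -- Here `g u ≤ t ≤ g v = f u ≤ g u`, so `g u = g v`, contradicting that `g` is proper.
  ... | no p | yes q = hg u v a (Fin.toℕ-injective (ℕ.≤-antisym
    (ℕ.≤-trans (ℕ.≤-pred (ℕ.≤-trans (ℕ.≰⇒> p) s≤1+t)) q)
    (ℕ.≤-trans (ℕ.≤-reflexive (cong toℕ (sym e))) (f≤g u))))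

  above-hom : ∀ t → IsHom (above t)
  above-hom t = above-compatible t t ℕ.≤-refl (ℕ.n≤1+n t)

  above-path : ∀ t → HomPath (above t) (above 0)
  above-path zero = done (above-hom 0) λ _ → refl
  above-path (suc t) = path-trans
    (switching-path (above-hom (suc t)) (above-hom t)
      (above-compatible t (suc t) (ℕ.n≤1+n t) ℕ.≤-refl))
    (above-path t)

  above-top : ∀ v → f v ≡ above (k + 2) v
  above-top v with (k + 2) ℕ.≤? toℕ (g v)
  ... | yes p = ⊥-elim (ℕ.<⇒≱ (Fin.toℕ<n (g v)) p)
  ... | no _ = refl

  ≤-path : HomPath f g
  ≤-path = path-respʳ (λ _ → refl) (path-respˡ above-top (above-path (k + 2)))

open Threshold using (≤-path)

-- Subsets of the cycle

next prev : Fin (suc ℓ) → Fin (suc ℓ)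
next x with view x
... | ‵fromℕ = zero
... | ‵inject₁ i = suc i
prev zero = fromℕ _
prev (suc x) = inject₁ x

next-fromℕ : ∀ ℓ → next (fromℕ ℓ) ≡ zero
next-fromℕ ℓ rewrite view-fromℕ ℓ = refl

next-inject₁ : (i : Fin ℓ) → next (inject₁ i) ≡ suc i
next-inject₁ i rewrite view-inject₁ i = refl

next-prev : (x : Fin (suc ℓ)) → next (prev x) ≡ x
next-prev zero = next-fromℕ _
next-prev (suc x) = next-inject₁ x

prev-next : (x : Fin (suc ℓ)) → prev (next x) ≡ x
prev-next x with view x
... | ‵fromℕ = refl
... | ‵inject₁ i = refl

next-injective : {x y : Fin (suc ℓ)} → next x ≡ next y → x ≡ y
next-injective {x = x} {y} e = trans (sym (prev-next x)) (trans (cong prev e) (prev-next y))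

prev-injective : {x y : Fin (suc ℓ)} → prev x ≡ prev y → x ≡ y
prev-injective {x = x} {y} e = trans (sym (next-prev x)) (trans (cong next e) (next-prev y))

toℕ-next : (x : Fin (suc ℓ)) → toℕ x ℕ.< ℓ → toℕ (next x) ≡ suc (toℕ x)
toℕ-next x lt with view x
... | ‵fromℕ = ⊥-elim (ℕ.<-irrefl (Fin.toℕ-fromℕ _) lt)
... | ‵inject₁ i = cong suc (sym (Fin.toℕ-inject₁ i))

toℕ-prev : (x : Fin (suc ℓ)) {j : ℕ} → toℕ x ≡ suc j → toℕ (prev x) ≡ j
toℕ-prev (suc x) e = trans (Fin.toℕ-inject₁ x) (ℕ.suc-injective e)

-- `P` is carried from `x` up to the last position, across the wrap to `zero`, and up again to `y`.
cycle-induction : (P : Fin (suc ℓ) → Set) → (∀ x → P x → P (next x)) → ∀ {x} → P x → ∀ y → P y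
cycle-induction {ℓ} P s {x} p = λ y → up (toℕ y) y refl
  where
  P-top : ∀ j x → toℕ x + j ≡ ℓ → P x → P (fromℕ ℓ)
  P-top zero x e p = subst P (Fin.toℕ-injective (trans (trans (sym (ℕ.+-identityʳ _)) e) (sym (Fin.toℕ-fromℕ ℓ)))) p
  P-top (suc j) x e p = P-top j (next x)
    (trans (cong (_+ j) (toℕ-next x (ℕ.≤-trans (ℕ.m≤m+n (suc (toℕ x)) j) (ℕ.≤-reflexive e′)))) e′) (s x p)
    where e′ = trans (sym (ℕ.+-suc (toℕ x) j)) e
  P-zero : P zero
  P-zero = subst P (next-fromℕ ℓ) (s _ (P-top (ℓ ℕ.∸ toℕ x) x (ℕ.m+[n∸m]≡n (Fin.toℕ≤pred[n] x)) p))
  up : ∀ j y → toℕ y ≡ j → P y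
  up zero zero _ = P-zero
  up (suc j) y e = subst P (next-prev y) (s _ (up j (prev y) (toℕ-prev y e)))

infix 4 _∋_ _∋?_ _⊆_

_∋_ : Vec Bool m → Fin m → Set
S ∋ x = lookup S x ≡ true

_∋?_ : (S : Vec Bool m) (x : Fin m) → Dec (S ∋ x)
S ∋? x = lookup S x Bool.≟ true

_⊆_ : Vec Bool m → Vec Bool m → Set
S ⊆ S′ = ∀ x → S ∋ x → S′ ∋ x

subset-ext : {S S′ : Vec Bool m} → S ⊆ S′ → S′ ⊆ S → S ≡ S′
subset-ext {S = S} {S′} p q =
  trans (sym (tabulate∘lookup S)) (trans (tabulate-cong same) (tabulate∘lookup S′))
  where
  same : ∀ x → lookup S x ≡ lookup S′ x
  same x with lookup S x in e | lookup S′ x in e′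
  ... | true | true = refl
  ... | false | false = refl
  ... | true | false = trans (sym (p x e)) e′
  ... | false | true = trans (sym e) (q x e′)

∌⇒false : ∀ {b} → ¬ b ≡ true → b ≡ false
∌⇒false {true} n = ⊥-elim (n refl)
∌⇒false {false} n = refl

false≢true : ∀ {b} → b ≡ false → ¬ b ≡ true
false≢true refl ()

private
  nand : ∀ {a b} → T (not (a ∧ b)) → a ≡ true → ¬ b ≡ true
  nand p refl refl = p

  nand⁻ : ∀ {a b} → (a ≡ true → ¬ b ≡ true) → T (not (a ∧ b))
  nand⁻ {true} {true} f = f refl refl
  nand⁻ {true} {false} f = _
  nand⁻ {false} f = _

disjoint⇒ : (S S′ : Vec Bool m) → T (disjointB S S′) → ∀ x → S ∋ x → ¬ S′ ∋ x
disjoint⇒ (a ∷ S) (b ∷ S′) p zero = nand (proj₁ (∧-split (not (a ∧ b)) p))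
disjoint⇒ (a ∷ S) (b ∷ S′) p (suc x) = disjoint⇒ S S′ (proj₂ (∧-split (not (a ∧ b)) p)) x

disjoint⇐ : (S S′ : Vec Bool m) → (∀ x → S ∋ x → ¬ S′ ∋ x) → T (disjointB S S′)
disjoint⇐ [] [] f = _
disjoint⇐ (a ∷ S) (b ∷ S′) f = ∧-pair (nand⁻ (f zero)) (disjoint⇐ S S′ (f ∘ suc))

Stable : Vec Bool (suc ℓ) → Set
Stable S = ∀ x → S ∋ x → ¬ S ∋ next x

noAdj⇒ : (S : Vec Bool (suc ℓ)) → T (noAdj S) → ∀ i → S ∋ inject₁ i → ¬ S ∋ suc i
noAdj⇒ (a ∷ b ∷ S) p zero = nand (proj₁ (∧-split (not (a ∧ b)) p))
noAdj⇒ (a ∷ b ∷ S) p (suc i) = noAdj⇒ (b ∷ S) (proj₂ (∧-split (not (a ∧ b)) p)) i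

noAdj⇐ : (S : Vec Bool (suc ℓ)) → (∀ i → S ∋ inject₁ i → ¬ S ∋ suc i) → T (noAdj S)
noAdj⇐ (a ∷ []) f = _
noAdj⇐ (a ∷ b ∷ S) f = ∧-pair (nand⁻ (f zero)) (noAdj⇐ (b ∷ S) (f ∘ suc))

lastB-lookup : ∀ x (S : Vec Bool ℓ) → lastB x S ≡ lookup (x ∷ S) (fromℕ ℓ)
lastB-lookup x [] = refl
lastB-lookup x (y ∷ S) = lastB-lookup y S

stableB⇒ : (S : Vec Bool (suc ℓ)) → T (stableB S) → Stable S
stableB⇒ {ℓ} (a ∷ S) p x with view x | ∧-split (noAdj (a ∷ S)) p
... | ‵fromℕ | _ , q = λ e e′ → nand q e′ (trans (lastB-lookup a S) e)
... | ‵inject₁ i | q , _ = noAdj⇒ (a ∷ S) q i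

stableB⇐ : (S : Vec Bool (suc ℓ)) → Stable S → T (stableB S)
stableB⇐ {ℓ} (a ∷ S) st = ∧-pair
  (noAdj⇐ (a ∷ S) λ i p q → st (inject₁ i) p (subst ((a ∷ S) ∋_) (sym (next-inject₁ i)) q))
  (nand⁻ λ p q → st (fromℕ ℓ) (trans (sym (lastB-lookup a S)) q) (subst ((a ∷ S) ∋_) (sym (next-fromℕ ℓ)) p))

bit : Bool → ℕ
bit b = if b then 1 else 0

card-sum : (S : Vec Bool m) → card S ≡ sum (bit ∘ lookup S)
card-sum [] = refl
card-sum (true ∷ S) = cong suc (card-sum S)
card-sum (false ∷ S) = card-sum S

card-permute : (S : Vec Bool m) (f g : Fin m → Fin m) → (∀ x → f (g x) ≡ x) → (∀ x → g (f x) ≡ x) →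
  card (tabulate (lookup S ∘ f)) ≡ card S
card-permute S f g fg gf = begin
  card (tabulate (lookup S ∘ f))            ≡⟨ card-sum (tabulate (lookup S ∘ f)) ⟩
  sum (bit ∘ lookup (tabulate (lookup S ∘ f))) ≡⟨ sum-cong-≗ (λ x → cong bit (lookup∘tabulate (lookup S ∘ f) x)) ⟩
  sum (bit ∘ lookup S ∘ f)                  ≡⟨ sum-permute (bit ∘ lookup S) (permutation f g fg gf) ⟨
  sum (bit ∘ lookup S)                      ≡⟨ card-sum S ⟨
  card S                                    ∎
  where open ≡-Reasoning

card-mono : (S S′ : Vec Bool m) → S ⊆ S′ → card S ℕ.≤ card S′
card-mono [] [] p = z≤n
card-mono (a ∷ S) (b ∷ S′) p with a | b | p zero | card-mono S S′ (p ∘ suc)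
... | false | false | _ | r = r
... | false | true | _ | r = ℕ.m≤n⇒m≤1+n r
... | true | true | _ | r = s≤s r
... | true | false | q | _ with () ← q refl

⊆-card-≡ : (S S′ : Vec Bool m) → S ⊆ S′ → card S ≡ card S′ → S ≡ S′
⊆-card-≡ [] [] p e = refl
⊆-card-≡ (false ∷ S) (false ∷ S′) p e = cong (false ∷_) (⊆-card-≡ S S′ (p ∘ suc) e)
⊆-card-≡ (false ∷ S) (true ∷ S′) p e = ⊥-elim (ℕ.<⇒≱ (ℕ.≤-reflexive (sym e)) (card-mono S S′ (p ∘ suc)))
⊆-card-≡ (true ∷ S) (false ∷ S′) p e with () ← p zero refl
⊆-card-≡ (true ∷ S) (true ∷ S′) p e = cong (true ∷_) (⊆-card-≡ S S′ (p ∘ suc) (ℕ.suc-injective e))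

card-insert : (S : Vec Bool m) (x : Fin m) → ¬ S ∋ x → card (S [ x ]≔ true) ≡ suc (card S)
card-insert (true ∷ S) zero n = ⊥-elim (n refl)
card-insert (false ∷ S) zero n = refl
card-insert (true ∷ S) (suc x) n = cong suc (card-insert S x n)
card-insert (false ∷ S) (suc x) n = card-insert S x n

card-delete : (S : Vec Bool m) (x : Fin m) → S ∋ x → suc (card (S [ x ]≔ false)) ≡ card S
card-delete (true ∷ S) zero n = refl
card-delete (true ∷ S) (suc x) n = cong suc (card-delete S x n)
card-delete (false ∷ S) (suc x) n = card-delete S x n

∋-insert-same : (S : Vec Bool m) (x : Fin m) → S [ x ]≔ true ∋ x
∋-insert-same S x = lookup∘updateAt x S

∋-insert-other : (S : Vec Bool m) (x : Fin m) {y : Fin m} → S ∋ y → S [ x ]≔ true ∋ y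
∋-insert-other S x {y} e with y Fin.≟ x
... | yes refl = ∋-insert-same S x
... | no ne = trans (lookup∘updateAt′ y x ne S) e

∋-insert⁻ : (S : Vec Bool m) (x : Fin m) {y : Fin m} → S [ x ]≔ true ∋ y → y ≡ x ⊎ S ∋ y
∋-insert⁻ S x {y} e with y Fin.≟ x
... | yes p = inj₁ p
... | no ne = inj₂ (trans (sym (lookup∘updateAt′ y x ne S)) e)

∌-delete-same : (S : Vec Bool m) (x : Fin m) → ¬ S [ x ]≔ false ∋ x
∌-delete-same S x = false≢true (lookup∘updateAt x S)

∋-delete : (S : Vec Bool m) (x : Fin m) {y : Fin m} → S ∋ y → y ≢ x → S [ x ]≔ false ∋ y
∋-delete S x {y} e ne = trans (lookup∘updateAt′ y x ne S) e

∋-delete⁻ : (S : Vec Bool m) (x : Fin m) {y : Fin m} → S [ x ]≔ false ∋ y → S ∋ y × y ≢ x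
∋-delete⁻ S x {y} e with y Fin.≟ x
... | yes refl = ⊥-elim (∌-delete-same S x e)
... | no ne = trans (sym (lookup∘updateAt′ y x ne S)) e , ne

subset-of-card : ∀ j (S : Vec Bool m) → j ℕ.≤ card S → ∃ λ R → R ⊆ S × card R ≡ j
subset-of-card zero [] le = [] , (λ _ p → p) , refl
subset-of-card j (false ∷ S) le with subset-of-card j S le
... | R , s , e = false ∷ R , (λ { zero () ; (suc x) → s x }) , e
subset-of-card zero (true ∷ S) le with subset-of-card zero S z≤n
... | R , s , e = false ∷ R , (λ { zero () ; (suc x) → s x }) , e
subset-of-card (suc j) (true ∷ S) (s≤s le) with subset-of-card j S le
... | R , s , e = true ∷ R , (λ { zero _ → refl ; (suc x) → s x }) , cong suc e

pointed-subset-of-card : ∀ j (S : Vec Bool m) → suc j ℕ.≤ card S → ∀ {x} → S ∋ x →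
  ∃ λ R → R ⊆ S × R ∋ x × card R ≡ suc j
pointed-subset-of-card j S le {x} p
  with subset-of-card j (S [ x ]≔ false) (ℕ.≤-pred (ℕ.≤-trans le (ℕ.≤-reflexive (sym (card-delete S x p)))))
... | R , s , e =
  R [ x ]≔ true , sub , ∋-insert-same R x ,
  trans (card-insert R x (∌-delete-same S x ∘ s x)) (cong suc e)
  where
  sub : R [ x ]≔ true ⊆ S
  sub y q with ∋-insert⁻ R x q
  ... | inj₁ refl = p
  ... | inj₂ r = proj₁ (∋-delete⁻ S x (s y r))

card-pos : (S : Vec Bool m) → 1 ℕ.≤ card S → ∃ λ x → S ∋ x
card-pos (true ∷ S) le = zero , refl
card-pos (false ∷ S) le with card-pos S le
... | x , p = suc x , p

-- Moves in stable Kneser graphs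

next²-≢ : ∀ {l} → 2 ℕ.≤ l → (x : Fin (suc l)) → next (next x) ≢ x
next²-≢ (s≤s (s≤s _)) x e
  with () ← cycle-induction (λ x → next (next x) ≡ x) (λ _ → cong next) {x} e zero

next-≢ : ∀ {l} → 2 ℕ.≤ l → (x : Fin (suc l)) → next x ≢ x
next-≢ le x e = next²-≢ le x (trans (cong next e) e)

sum-mono : ∀ {m} (f g : Fin m → ℕ) → (∀ x → f x ℕ.≤ g x) → sum f ℕ.≤ sum g
sum-mono {zero} f g le = z≤n
sum-mono {suc m} f g le = ℕ.+-mono-≤ (le zero) (sum-mono (f ∘ suc) (g ∘ suc) (le ∘ suc))

sum-tight : ∀ {m} (f g : Fin m → ℕ) → (∀ x → f x ℕ.≤ g x) → sum f ≡ sum g → ∀ x → f x ≡ g x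
sum-tight {suc m} f g le e = go
  where
  tail≤ = sum-mono (f ∘ suc) (g ∘ suc) (le ∘ suc)
  head≡ : f zero ≡ g zero
  head≡ = ℕ.≤-antisym (le zero) (ℕ.≮⇒≥ λ lt → ℕ.<⇒≢ (ℕ.+-mono-<-≤ lt tail≤) e)
  go : ∀ x → f x ≡ g x
  go zero = head≡
  go (suc x) = sum-tight (f ∘ suc) (g ∘ suc) (le ∘ suc)
    (ℕ.+-cancelˡ-≡ (g zero) _ _ (trans (cong (_+ sum (f ∘ suc)) (sym head≡)) e)) x

sum-ones : ∀ m → sum {m} (λ _ → 1) ≡ m
sum-ones zero = refl
sum-ones (suc m) = cong suc (sum-ones m)

shift-card : ∀ {l} (S : Vec Bool (suc l)) → card (tabulate (lookup S ∘ prev)) ≡ card S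
shift-card S = card-permute S prev next prev-next next-prev

Nbr : ∀ {l} → Fin (suc l) → Fin (suc l) → Set
Nbr x y = next x ≡ y ⊎ next y ≡ x

Nbr-sym : ∀ {l} {x y : Fin (suc l)} → Nbr x y → Nbr y x
Nbr-sym (inj₁ e) = inj₂ e
Nbr-sym (inj₂ e) = inj₁ e

Nbr? : ∀ {l} (x y : Fin (suc l)) → Dec (Nbr x y)
Nbr? x y = (next x Fin.≟ y) ⊎-dec (next y Fin.≟ x)

other-neighbour : ∀ {l} {a b y z : Fin (suc l)} → Nbr a b → Nbr a y → Nbr a z → y ≢ b → z ≢ b → y ≡ z
other-neighbour p (inj₁ refl) (inj₁ refl) _ _ = refl
other-neighbour p (inj₂ e) (inj₂ e′) _ _ = next-injective (trans e (sym e′))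
other-neighbour (inj₁ e″) (inj₁ e) (inj₂ e′) ne _ = ⊥-elim (ne (trans (sym e) e″))
other-neighbour (inj₂ e″) (inj₁ e) (inj₂ e′) _ ne = ⊥-elim (ne (next-injective (trans e′ (sym e″))))
other-neighbour (inj₁ e″) (inj₂ e) (inj₁ e′) _ ne = ⊥-elim (ne (trans (sym e′) e″))
other-neighbour (inj₂ e″) (inj₂ e) (inj₁ e′) ne _ = ⊥-elim (ne (next-injective (trans e (sym e″))))

inverse : ∀ {n k} → Automorphism n k → Automorphism n k
inverse γ = record
  { fun = inv ; inv = fun ; inv-fun = fun-inv ; fun-inv = inv-fun
  ; adj-pres = λ u v a → adj-refl (inv u) (inv v) (subst₂ SGAdj (sym (fun-inv u)) (sym (fun-inv v)) a)
  ; adj-refl = λ u v a → subst₂ SGAdj (fun-inv u) (fun-inv v) (adj-pres (inv u) (inv v) a) }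
  where open Automorphism γ

compose : ∀ {n k} → Automorphism n k → Automorphism n k → Automorphism n k
compose γ δ = record
  { fun = γ.fun ∘ δ.fun ; inv = δ.inv ∘ γ.inv
  ; inv-fun = λ v → trans (cong δ.inv (γ.inv-fun _)) (δ.inv-fun v)
  ; fun-inv = λ v → trans (cong γ.fun (δ.fun-inv _)) (γ.fun-inv v)
  ; adj-pres = λ u v → γ.adj-pres _ _ ∘ δ.adj-pres u v
  ; adj-refl = λ u v → δ.adj-refl u v ∘ γ.adj-refl _ _ }
  where
  module γ = Automorphism γ
  module δ = Automorphism δ

-- Throughout, n = 1 + p and m = 2n + k = 1 + l.
module Stable-Kneser (p k : ℕ) (p≥1 : 1 ℕ.≤ p) (k≥1 : 1 ℕ.≤ k) where

  -- This is `2 * suc p + k` unfolded with its leading `suc` removed, so that the subsets in `V` are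
  -- by definition vectors of length `suc l`.
  l : ℕ
  l = p + (suc p + 0) + k

  V : Set
  V = SGVertex (suc p) k

  Pos : Set
  Pos = Fin (suc l)

  l≥2 : 2 ℕ.≤ l
  l≥2 = ℕ.≤-trans (ℕ.+-mono-≤ p≥1 (s≤s z≤n)) (ℕ.m≤m+n _ k)

  infix 4 _∈_ _∉_ _∈?_

  record _∈_ (x : Pos) (v : V) : Set where
    constructor ∋⇒∈
    field ∈⇒∋ : proj₁ v ∋ x
  open _∈_

  _∉_ : Pos → V → Set
  x ∉ v = ¬ x ∈ v

  _∈?_ : (x : Pos) (v : V) → Dec (x ∈ v)
  x ∈? v = map′ ∋⇒∈ ∈⇒∋ (proj₁ v ∋? x)

  abstract
    stable : (v : V) → Stable (proj₁ v)
    stable v = stableB⇒ (proj₁ v) (proj₁ (∧-split (stableB (proj₁ v)) (proj₂ v)))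

  nonadjacent : (v : V) {x y : Pos} → Nbr x y → x ∈ v → y ∉ v
  nonadjacent v (inj₁ refl) (∋⇒∈ p) (∋⇒∈ q) = stable v _ p q
  nonadjacent v (inj₂ refl) (∋⇒∈ p) (∋⇒∈ q) = stable v _ q p

  stable′ : (v : V) (x : Pos) → x ∈ v → next x ∉ v
  stable′ v x = nonadjacent v (inj₁ refl)

  abstract
    card-vertex : (v : V) → card (proj₁ v) ≡ suc p
    card-vertex v = ℕ.≡ᵇ⇒≡ _ _ (proj₂ (∧-split (stableB (proj₁ v)) (proj₂ v)))

  mk : (S : Vec Bool (suc l)) → Stable S → card S ≡ suc p → V
  mk S st c = S , ∧-pair (stableB⇐ S st) (ℕ.≡⇒≡ᵇ _ _ c)

  adj⇒ : {u v : V} → SGAdj u v → ∀ {x} → x ∈ u → x ∉ v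
  adj⇒ {u} {v} a (∋⇒∈ i) (∋⇒∈ j) = disjoint⇒ (proj₁ u) (proj₁ v) a _ i j

  adj⇐ : {u v : V} → (∀ {x} → x ∈ u → x ∉ v) → SGAdj u v
  adj⇐ {u} {v} f = disjoint⇐ (proj₁ u) (proj₁ v) λ _ i j → f (∋⇒∈ i) (∋⇒∈ j)

  ⊆⇒≡ : {u v : V} → (∀ {x} → x ∈ u → x ∈ v) → u ≡ v
  ⊆⇒≡ {u} {v} s = vertex-≡ (⊆-card-≡ (proj₁ u) (proj₁ v) (λ _ i → ∈⇒∋ (s (∋⇒∈ i)))
    (trans (card-vertex u) (sym (card-vertex v))))

  missing : {u v : V} → u ≢ v → ∃ λ x → x ∈ u × x ∉ v
  missing {u} {v} ne with Fin.any? (λ x → (x ∈? u) ×-dec ¬? (x ∈? v))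
  ... | yes r = r
  ... | no none = ⊥-elim (ne (⊆⇒≡ λ {x} i → decidable-stable (x ∈? v) λ n → none (x , i , n)))

  -- For `t ∉ s` this is exactly the condition for exchanging some element of `s` for `t`: every
  -- neighbour of `t` in `s` has to be the removed element.
  Free : V → Pos → Set
  Free s t = ¬ (next t ∈ s × prev t ∈ s)

  -- If no such t exists, each element of u ∖ s lies between two elements of s ∖ u; counting
  -- turns this into an alternation of u ∖ s and s ∖ u around the whole cycle, so m ≤ 2n.
  abstract
    free-difference : {s u : V} → s ≢ u → ∃ λ t → t ∈ u × t ∉ s × Free s t
    free-difference {s} {u} ne
      with Fin.any? (λ t → (t ∈? u) ×-dec ¬? (t ∈? s) ×-dec ¬? ((next t ∈? s) ×-dec (prev t ∈? s)))
    ... | yes r = r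
    ... | no none = ⊥-elim (ℕ.<⇒≱ m>2n m≤2n)
      where
      f g h : Pos → ℕ
      f x = bit (lookup (proj₁ u) x ∧ not (lookup (proj₁ s) x))
      g x = bit (lookup (proj₁ s) x ∧ not (lookup (proj₁ u) x))
      h x = bit (lookup (proj₁ s) x ∧ lookup (proj₁ u) x)

      split : ∀ (a b : Bool) → bit a ≡ bit (a ∧ not b) + bit (b ∧ a)
      split true true = refl
      split true false = refl
      split false true = refl
      split false false = refl

      sum-u : suc p ≡ sum f + sum h
      sum-u = trans (sym (card-vertex u)) (trans (card-sum (proj₁ u))
        (trans (sum-cong-≗ (λ x → split (lookup (proj₁ u) x) (lookup (proj₁ s) x))) (∑-distrib-+ {suc l} f h)))

      sum-s : suc p ≡ sum g + sum h
      sum-s = trans (sym (card-vertex s)) (trans (card-sum (proj₁ s))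
        (trans (sum-cong-≗ (λ x → trans (split (lookup (proj₁ s) x) (lookup (proj₁ u) x))
            (cong (λ b → g x + bit b) (Bool.∧-comm (lookup (proj₁ u) x) (lookup (proj₁ s) x)))))
          (∑-distrib-+ {suc l} g h)))

      f≡g : sum f ≡ sum g
      f≡g = ℕ.+-cancelʳ-≡ (sum h) _ _ (trans (sym sum-u) sum-s)

      between : ∀ t → t ∈ u → t ∉ s → next t ∈ s × prev t ∈ s
      between t i n = decidable-stable ((next t ∈? s) ×-dec (prev t ∈? s)) λ fr → none (t , i , n , fr)

      f-one : ∀ {x} → x ∈ u → x ∉ s → f x ≡ 1
      f-one i n rewrite ∈⇒∋ i | ∌⇒false (n ∘ ∋⇒∈) = refl

      g-one : ∀ {x} → x ∈ s → x ∉ u → g x ≡ 1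
      g-one i n rewrite ∈⇒∋ i | ∌⇒false (n ∘ ∋⇒∈) = refl

      f≤ : ∀ {x c} → (x ∈ u → x ∉ s → c ≡ 1) → f x ℕ.≤ c
      f≤ {x} e with lookup (proj₁ u) x in i | lookup (proj₁ s) x in j
      ... | true | false = ℕ.≤-reflexive (sym (e (∋⇒∈ i) λ (∋⇒∈ j′) → false≢true j j′))
      ... | true | true = z≤n
      ... | false | _ = z≤n

      f∘prev : ∀ x → f (prev x) ≡ g x
      f∘prev = sum-tight (f ∘ prev) g
        (λ x → f≤ λ i n → g-one (subst (_∈ s) (next-prev x) (proj₁ (between _ i n)))
                                (subst (_∉ u) (next-prev x) (stable′ u _ i)))
        (trans (sym (sum-permute f (permutation prev next prev-next next-prev))) f≡g)

      f∘next : ∀ x → f (next x) ≡ g x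
      f∘next = sum-tight (f ∘ next) g
        (λ x → f≤ λ i n → g-one (subst (_∈ s) (prev-next x) (proj₂ (between _ i n)))
                                (λ j → stable′ u _ j i))
        (trans (sym (sum-permute f (permutation next prev next-prev prev-next))) f≡g)

      -- By the two equalities above, passing from `x` to `next x` interchanges the values of `f`
      -- and `g`. Their sum is therefore constant around the cycle, and it is positive where `s` and
      -- `u` differ.
      f+g-const : ∀ x → 1 ℕ.≤ f x + g x → 1 ℕ.≤ f (next x) + g (next x)
      f+g-const x le = ℕ.≤-trans le (ℕ.≤-reflexive
        (trans (ℕ.+-comm (f x) (g x))
          (cong₂ _+_ (sym (f∘next x)) (trans (cong f (sym (prev-next x))) (f∘prev (next x))))))

      f+g≥1 : ∀ x → 1 ℕ.≤ f x + g x
      f+g≥1 = let t , i , n = missing (ne ∘ sym) in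
        cycle-induction (λ x → 1 ℕ.≤ f x + g x) f+g-const {t}
          (ℕ.≤-trans (ℕ.≤-reflexive (sym (f-one i n))) (ℕ.m≤m+n _ _))

      m≤2n : suc l ℕ.≤ suc p + suc p
      m≤2n = ℕ.≤-trans (ℕ.≤-reflexive (sym (sum-ones (suc l))))
        (ℕ.≤-trans (sum-mono (λ _ → 1) (λ x → f x + g x) f+g≥1)
          (ℕ.≤-trans (ℕ.≤-reflexive (∑-distrib-+ {suc l} f g))
            (ℕ.+-mono-≤ (ℕ.≤-trans (ℕ.m≤m+n (sum f) (sum h)) (ℕ.≤-reflexive (sym sum-u)))
                        (ℕ.≤-trans (ℕ.m≤m+n (sum g) (sum h)) (ℕ.≤-reflexive (sym sum-s))))))

      m>2n : suc p + suc p ℕ.< suc l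
      m>2n = ℕ.≤-trans (ℕ.≤-reflexive (trans (cong suc (cong (suc p +_) (sym (ℕ.+-identityʳ _)))) (ℕ.+-comm 1 _)))
        (ℕ.+-monoʳ-≤ (suc p + (suc p + 0)) k≥1)

  -- Start from the translate s + 1, which is disjoint from s, force z into it and y out of it.
  abstract
    separating-neighbour : (s : V) {y z : Pos} → y ∉ s → Free s y → z ∉ s → z ≢ y →
      ∃ λ r → SGAdj s r × z ∈ r × y ∉ r
    separating-neighbour s {y} {z} y∉s y-free z∉s z≢y = result
      where
      S S⁺ : Vec Bool (suc l)
      S = proj₁ s
      S⁺ = tabulate (lookup S ∘ prev)

      ∈S⁺⁻ : ∀ x → S⁺ ∋ x → prev x ∈ s
      ∈S⁺⁻ x i = ∋⇒∈ (trans (sym (lookup∘tabulate (lookup S ∘ prev) x)) i)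

      ∉s : ∀ {x} → prev x ∈ s → x ∉ s
      ∉s {x} i j = stable′ s (prev x) i (subst (_∈ s) (sym (next-prev x)) j)

      next∉S⁺ : ∀ {x} → x ∉ s → ¬ S⁺ ∋ next x
      next∉S⁺ {x} n i = n (subst (_∈ s) (prev-next x) (∈S⁺⁻ (next x) i))

      W₀ W : Vec Bool (suc l)
      -- Only `prev z` can conflict with `z` in the translate: if `next z` were in it, `z` would lie
      -- in `s`.
      W₀ = S⁺ [ prev z ]≔ false
      W = W₀ [ z ]≔ true

      card-S⁺ : card S⁺ ≡ suc p
      card-S⁺ = trans (shift-card S) (card-vertex s)

      W⁻ : ∀ {x} → W ∋ x → x ≡ z ⊎ (prev x ∈ s × x ≢ prev z)
      W⁻ {x} i with ∋-insert⁻ W₀ z i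
      ... | inj₁ e = inj₁ e
      ... | inj₂ j with ∋-delete⁻ S⁺ (prev z) j
      ...   | q , ne = inj₂ (∈S⁺⁻ x q , ne)

      z∉ : prev (prev z) ∈ s → ¬ S⁺ ∋ z
      z∉ i j = ∉s i (∈S⁺⁻ z j)

      S⁺⊆W : ¬ S⁺ ∋ prev z → S⁺ ⊆ W
      S⁺⊆W n x i = ∋-insert-other W₀ z (∋-delete S⁺ (prev z) i λ { refl → n i })

      card-W : suc p ℕ.≤ card W
      card-W with S⁺ ∋? prev z
      ... | no n = ℕ.≤-trans (ℕ.≤-reflexive (sym card-S⁺)) (card-mono S⁺ W (S⁺⊆W n))
      ... | yes i = ℕ.≤-reflexive (sym (trans (card-insert W₀ z (z∉ (∈S⁺⁻ (prev z) i) ∘ proj₁ ∘ ∋-delete⁻ S⁺ (prev z)))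
                                        (trans (card-delete S⁺ (prev z) i) card-S⁺)))

      W-stable : Stable W
      W-stable x i j with W⁻ i | W⁻ j
      ... | inj₁ refl | inj₁ e = next-≢ l≥2 _ e
      ... | inj₁ refl | inj₂ (q , _) = z∉s (subst (_∈ s) (prev-next x) q)
      ... | inj₂ (_ , ne) | inj₁ e = ne (trans (sym (prev-next x)) (cong prev e))
      ... | inj₂ (q , _) | inj₂ (q′ , _) = ∉s q (subst (_∈ s) (prev-next x) q′)

      W-disjoint : ∀ {x} → x ∈ s → ¬ W ∋ x
      W-disjoint i j with W⁻ j
      ... | inj₁ refl = z∉s i
      ... | inj₂ (q , _) = ∉s q i

      shrink : (W : Vec Bool (suc l)) → Stable W → (∀ {x} → x ∈ s → ¬ W ∋ x) →
        W ∋ z → ¬ W ∋ y → suc p ℕ.≤ card W → ∃ λ r → SGAdj s r × z ∈ r × y ∉ r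
      shrink W st dj z∈ y∉ le with pointed-subset-of-card p W le z∈
      ... | R , R⊆W , z∈R , c =
        r , adj⇐ {s} {r} (λ i j → dj i (R⊆W _ (∈⇒∋ j))) , ∋⇒∈ z∈R , λ i → y∉ (R⊆W _ (∈⇒∋ i))
        where
        r : V
        r = mk R (λ x i j → st x (R⊆W _ i) (R⊆W _ j)) c

      z∈W : W ∋ z
      z∈W = ∋-insert-same W₀ z

      result : ∃ λ r → SGAdj s r × z ∈ r × y ∉ r
      result with W ∋? y
      ... | no y∉W = shrink W W-stable W-disjoint z∈W y∉W card-W
      ... | yes y∈W with W⁻ y∈W
      ...   | inj₁ e = ⊥-elim (z≢y (sym e))
      ...   | inj₂ (y⁻∈s , y≢z⁻) with next (next y) Fin.≟ z
      ...     | yes e = shrink W₁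
        (λ x i j → W-stable x (proj₁ (∋-delete⁻ W y i)) (proj₁ (∋-delete⁻ W y j)))
        (λ i j → W-disjoint i (proj₁ (∋-delete⁻ W y j)))
        (∋-delete W y z∈W z≢y) (∌-delete-same W y) card-W₁
        where
        W₁ : Vec Bool (suc l)
        W₁ = W [ y ]≔ false
        z⁻ : prev z ≡ next y
        z⁻ = trans (cong prev (sym e)) (prev-next _)
        y⁺∉s : next y ∉ s
        y⁺∉s i = y-free (i , y⁻∈s)
        z⁻∉ : ¬ S⁺ ∋ prev z
        z⁻∉ i = next∉S⁺ y∉s (subst (S⁺ ∋_) z⁻ i)
        S⁺z⊆W : S⁺ [ z ]≔ true ⊆ W
        S⁺z⊆W x i with ∋-insert⁻ S⁺ z i
        ... | inj₁ refl = z∈W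
        ... | inj₂ j = S⁺⊆W z⁻∉ x j
        card-W₁ : suc p ℕ.≤ card W₁
        card-W₁ = ℕ.≤-pred (ℕ.≤-trans
          (ℕ.≤-reflexive (trans (cong suc (sym card-S⁺))
            (sym (card-insert S⁺ z λ i → y⁺∉s (subst (_∈ s) z⁻ (∈S⁺⁻ z i))))))
          (ℕ.≤-trans (card-mono (S⁺ [ z ]≔ true) W S⁺z⊆W) (ℕ.≤-reflexive (sym (card-delete W y y∈W)))))
      -- Otherwise `y` is shifted to `next y`, which is outside `s` because `y` is free and
      -- `prev y ∈ s`.
      ...     | no ne = shrink W₂ st dj (∋-insert-other W₁ (next y) (∋-delete W y z∈W z≢y)) y∉
        (ℕ.≤-trans card-W (ℕ.≤-reflexive (sym (trans (card-insert W₁ (next y) (y⁺∉W ∘ proj₁ ∘ ∋-delete⁻ W y))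
                                                      (card-delete W y y∈W)))))
        where
        W₁ W₂ : Vec Bool (suc l)
        W₁ = W [ y ]≔ false
        W₂ = W₁ [ next y ]≔ true
        y⁺∉s : next y ∉ s
        y⁺∉s i = y-free (i , y⁻∈s)
        y⁺∉W : ¬ W ∋ next y
        y⁺∉W i with W⁻ i
        ... | inj₁ e = y≢z⁻ (trans (sym (prev-next y)) (cong prev e))
        ... | inj₂ (q , _) = y∉s (subst (_∈ s) (prev-next y) q)
        y∉ : ¬ W₂ ∋ y
        y∉ i with ∋-insert⁻ W₁ (next y) i
        ... | inj₁ e = next-≢ l≥2 y (sym e)
        ... | inj₂ j = ∌-delete-same W y j
        dj : ∀ {x} → x ∈ s → ¬ W₂ ∋ x
        dj i j with ∋-insert⁻ W₁ (next y) j
        ... | inj₁ refl = y⁺∉s i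
        ... | inj₂ q = W-disjoint i (proj₁ (∋-delete⁻ W y q))
        st : Stable W₂
        st x i j with ∋-insert⁻ W₁ (next y) i | ∋-insert⁻ W₁ (next y) j
        ... | _ | inj₁ e = y∉ (subst (W₂ ∋_) (next-injective e) i)
        ... | inj₂ q | inj₂ q′ = W-stable x (proj₁ (∋-delete⁻ W y q)) (proj₁ (∋-delete⁻ W y q′))
        ... | inj₁ refl | inj₂ q with W⁻ (proj₁ (∋-delete⁻ W y q))
        ...   | inj₁ e = ne e
        ...   | inj₂ (q′ , _) = y⁺∉s (subst (_∈ s) (prev-next (next y)) q′)

  -- Exchanging one element, in terms of the graph

  record Swap (s u : V) (x y : Pos) : Set where
    field
      x∈s : x ∈ s
      x∉u : x ∉ u
      y∈u : y ∈ u
      y∉s : y ∉ s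
      to : ∀ {z} → z ∈ u → z ≡ y ⊎ z ∈ s
      from : ∀ {z} → z ∈ s → z ≡ x ⊎ z ∈ u
  open Swap

  abstract
    swap : (s : V) {x y : Pos} → x ∈ s → y ∉ s → (∀ {a} → a ∈ s → Nbr a y → a ≡ x) → ∃ λ u → Swap s u x y
    swap s {x} {y} x∈s y∉s nbr = u , record
      { x∈s = x∈s ; y∉s = y∉s
      ; x∉u = x∉U ∘ ∈⇒∋ ; y∈u = ∋⇒∈ (∋-insert-same S₀ y) ; to = U⁻ ∘ ∈⇒∋
      ; from = from′ }
      where
      S₀ U : Vec Bool (suc l)
      S₀ = proj₁ s [ x ]≔ false
      U = S₀ [ y ]≔ true
      S₀⁻ : ∀ {z} → S₀ ∋ z → z ∈ s × z ≢ x
      S₀⁻ i with ∋-delete⁻ (proj₁ s) x i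
      ... | q , ne = ∋⇒∈ q , ne
      U⁻ : ∀ {z} → U ∋ z → z ≡ y ⊎ z ∈ s
      U⁻ i with ∋-insert⁻ S₀ y i
      ... | inj₁ e = inj₁ e
      ... | inj₂ q = inj₂ (proj₁ (S₀⁻ q))
      x∉U : ¬ U ∋ x
      x∉U i with ∋-insert⁻ S₀ y i
      ... | inj₁ refl = y∉s x∈s
      ... | inj₂ q = ∌-delete-same (proj₁ s) x q
      st : Stable U
      st z i j with ∋-insert⁻ S₀ y i | ∋-insert⁻ S₀ y j
      ... | inj₁ refl | inj₁ e = next-≢ l≥2 _ e
      ... | inj₂ q | inj₂ q′ = stable′ s z (proj₁ (S₀⁻ q)) (proj₁ (S₀⁻ q′))
      ... | inj₁ refl | inj₂ q = proj₂ (S₀⁻ q) (nbr (proj₁ (S₀⁻ q)) (inj₂ refl))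
      ... | inj₂ q | inj₁ refl = proj₂ (S₀⁻ q) (nbr (proj₁ (S₀⁻ q)) (inj₁ refl))
      u : V
      u = mk U st (trans (card-insert S₀ y (y∉s ∘ proj₁ ∘ S₀⁻))
                         (trans (card-delete (proj₁ s) x (∈⇒∋ x∈s)) (card-vertex s)))
      from′ : ∀ {z} → z ∈ s → z ≡ x ⊎ z ∈ u
      from′ {z} (∋⇒∈ i) with z Fin.≟ x
      ... | yes e = inj₁ e
      ... | no ne = inj₂ (∋⇒∈ (∋-insert-other S₀ y (∋-delete (proj₁ s) x i ne)))

  swap-unique : ∀ {s u w x y} → Swap s u x y → Swap s w x y → u ≡ w
  swap-unique {s} {u} {w} {y = y} σ τ = ⊆⇒≡ λ i → sub (to σ i) i
    where
    sub : ∀ {z} → z ≡ y ⊎ z ∈ s → z ∈ u → z ∈ w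
    sub (inj₁ refl) _ = y∈u τ
    sub (inj₂ j) i with from τ j
    ... | inj₁ refl = ⊥-elim (x∉u σ i)
    ... | inj₂ q = q

  swap-≢ : ∀ {s u x y} → Swap s u x y → u ≢ s
  swap-≢ σ refl = y∉s σ (y∈u σ)

  swap-nbr : ∀ {s u x y a} → Swap s u x y → a ∈ s → Nbr a y → a ≡ x
  swap-nbr {u = u} σ i nb with from σ i
  ... | inj₁ e = e
  ... | inj₂ j = ⊥-elim (nonadjacent u nb j (y∈u σ))

  -- Both neighbours of `y` would have to be the one removed element `x`, impossible on a cycle with
  -- at least three positions.
  swap-free : ∀ {s u x y} → Swap s u x y → Free s y
  swap-free {y = y} σ (i , j) = next²-≢ l≥2 y
    (trans (cong next (trans (swap-nbr σ i (inj₂ refl)) (sym (swap-nbr σ j (inj₁ (next-prev y))))))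
           (next-prev y))

  -- Common neighbours of `s` and `u` are the vertices disjoint from `s ∪ u`, so this is a
  -- graph-theoretic substitute for `w ⊆ s ∪ u`; `leq⇒` and `leq⇐` identify the two when `u` is a
  -- swap of `s`.
  record Leq (s u w : V) : Set where
    constructor ⇒leq
    field leq : ∀ r → SGAdj s r → SGAdj u r → SGAdj w r
  open Leq

  -- An element `z` of `w` outside `s ∪ {y}` lies in some `r` that avoids `s` and `y`; this `r` is
  -- adjacent to `s` and `u` but not to `w`.
  leq⇒ : ∀ {s u w x y} → Swap s u x y → Leq s u w → ∀ {z} → z ∈ w → z ≡ y ⊎ z ∈ s
  leq⇒ {s} {u} {w} {x} {y} σ le {z} i with z Fin.≟ y | z ∈? s
  ... | yes e | _ = inj₁ e
  ... | no _ | yes j = inj₂ j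
  ... | no z≢y | no z∉s with separating-neighbour s (y∉s σ) (swap-free σ) z∉s z≢y
  ...   | r , s~r , z∈r , y∉r = ⊥-elim (adj⇒ {w} {r} (leq le r s~r (adj⇐ {u} {r} λ j → u~r (to σ j))) i z∈r)
    where
    u~r : ∀ {a} → a ≡ y ⊎ a ∈ s → a ∉ r
    u~r (inj₁ refl) = y∉r
    u~r (inj₂ j) = adj⇒ {s} {r} s~r j

  leq⇐ : ∀ {s u w y} → y ∈ u → (∀ {z} → z ∈ w → z ≡ y ⊎ z ∈ s) → Leq s u w
  leq⇐ {s} {u} {w} {y} y∈u sub = ⇒leq λ r s~r u~r → adj⇐ {w} {r} λ i → go r s~r u~r (sub i)
    where
    go : ∀ r → SGAdj s r → SGAdj u r → ∀ {a} → a ≡ y ⊎ a ∈ s → a ∉ r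
    go r s~r u~r (inj₁ refl) = adj⇒ {u} {r} u~r y∈u
    go r s~r u~r (inj₂ j) = adj⇒ {s} {r} s~r j

  -- Graph-theoretic descriptions of "u arises from s by exchanging one element" and
  -- "… by moving one element to a neighbouring position".
  Near Move : V → V → Set
  Near s u = u ≢ s × (∀ w → w ≢ s → Leq s u w → Leq s w u)
  Move s u = u ≢ s × (∀ w → w ≢ s → Leq s u w → w ≡ u)

  abstract
    -- The `t` of `free-difference` has at most one neighbour in `s`. Such a neighbour is removed,
    -- and is not in `u` because `t ∈ u`; without one, any element of `s ∖ u` may go. Since
    -- `w ⊆ s ∪ {t}`, this provides a test vertex with `Leq s u w`.
    nearby-swap : ∀ {s u} → s ≢ u → ∃ λ w → ∃ λ x → ∃ λ t → Swap s w x t × t ∈ u × x ∉ u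
    nearby-swap {s} {u} ne with free-difference ne
    ... | t , t∈u , t∉s , free with next t ∈? s | prev t ∈? s
    ... | yes i | yes j = ⊥-elim (free (i , j))
    ... | yes i | no n =
      let w , σ = swap s i t∉s λ { a∈ (inj₁ e) → ⊥-elim (n (subst (_∈ s) (trans (sym (prev-next _)) (cong prev e)) a∈))
                                 ; _ (inj₂ e) → sym e }
      in w , _ , t , σ , t∈u , stable′ u t t∈u
    ... | no n | yes j =
      let w , σ = swap s j t∉s λ { _ (inj₁ e) → trans (sym (prev-next _)) (cong prev e)
                                 ; a∈ (inj₂ e) → ⊥-elim (n (subst (_∈ s) (sym e) a∈)) }
      in w , _ , t , σ , t∈u , λ i → stable′ u _ i (subst (_∈ u) (sym (next-prev t)) t∈u)
    ... | no n | no n′ with missing ne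
    ...   | x , x∈s , x∉u =
      let w , σ = swap s x∈s t∉s λ { a∈ (inj₁ e) → ⊥-elim (n′ (subst (_∈ s) (trans (sym (prev-next _)) (cong prev e)) a∈))
                                   ; a∈ (inj₂ e) → ⊥-elim (n (subst (_∈ s) (sym e) a∈)) }
      in w , x , t , σ , t∈u , x∉u

  swap-leq : ∀ {s u w x y} → Swap s w x y → y ∈ u → Leq s u w
  swap-leq σ y∈u = leq⇐ y∈u (to σ)

  abstract
    -- Maximality, applied to the `w` of `nearby-swap`, yields `u ⊆ s ∪ {y}`; with `x ∉ u` this
    -- leaves `u ⊆ w`, an equality by cardinality.
    near⇒swap : ∀ {s u} → Near s u → ∃ λ x → ∃ λ y → Swap s u x y
    near⇒swap {s} {u} (u≢s , mx) with nearby-swap (u≢s ∘ sym)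
    ... | w , x , y , σ , y∈u , x∉u = x , y , subst (λ v → Swap s v x y) (sym u≡w) σ
      where
      sub : ∀ {z} → z ≡ y ⊎ z ∈ s → z ∈ u → z ∈ w
      sub (inj₁ refl) _ = Swap.y∈u σ
      sub (inj₂ j) i with from σ j
      ... | inj₁ refl = ⊥-elim (x∉u i)
      ... | inj₂ q = q
      u≡w : u ≡ w
      u≡w = ⊆⇒≡ λ i → sub (leq⇒ σ (mx w (swap-≢ σ) (swap-leq σ y∈u)) i) i

  leq-∋ : ∀ {s u w x y} → Swap s u x y → w ≢ s → Leq s u w → y ∈ w
  leq-∋ {s} {u} {w} {x} {y} σ w≢s le = decidable-stable (y ∈? w) λ n →
    w≢s (⊆⇒≡ λ i → drop n (leq⇒ σ le i) i)
    where
    drop : y ∉ w → ∀ {z} → z ≡ y ⊎ z ∈ s → z ∈ w → z ∈ s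
    drop n (inj₁ refl) i = ⊥-elim (n i)
    drop n (inj₂ j) _ = j

  swap⇒near : ∀ {s u x y} → Swap s u x y → Near s u
  swap⇒near σ = swap-≢ σ , λ w w≢s le → swap-leq σ (leq-∋ σ w≢s le)

  abstract
    -- An n-subset of `s ∪ {y}` other than `s` contains `y`, so stability excludes the adjacent `x`,
    -- and only `u` is left.
    step⇒move : ∀ {s u x y} → Swap s u x y → Nbr x y → Move s u
    step⇒move {s} {u} {x} {y} σ nb = swap-≢ σ , λ w w≢s le →
      let y∈w = leq-∋ σ w≢s le in
      ⊆⇒≡ λ i → sub w y∈w (leq⇒ σ le i) i
      where
      sub : ∀ w → y ∈ w → ∀ {z} → z ≡ y ⊎ z ∈ s → z ∈ w → z ∈ u
      sub w y∈w (inj₁ refl) _ = y∈u σ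
      sub w y∈w (inj₂ j) i with from σ j
      ... | inj₁ refl = ⊥-elim (nonadjacent w nb i y∈w)
      ... | inj₂ q = q

  abstract
    -- If `x` and `y` were not adjacent, `y` would have no neighbour in `s`, and a second element of
    -- `s`, which exists by `p≥1`, could be exchanged for `y` instead, contradicting uniqueness.
    move⇒step : ∀ {s u} → Move s u → ∃ λ x → ∃ λ y → Swap s u x y × Nbr x y
    move⇒step {s} {u} (u≢s , un) with nearby-swap (u≢s ∘ sym)
    ... | w , x , y , σ , y∈u , x∉u with un w (swap-≢ σ) (swap-leq σ y∈u)
    ...   | refl with Nbr? x y
    ...     | yes nb = x , y , σ , nb
    ...     | no nnb = ⊥-elim (contra (card-pos S₀ S₀≥1))
      where
      S₀ : Vec Bool (suc l)
      S₀ = proj₁ s [ x ]≔ false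
      S₀≥1 : 1 ℕ.≤ card S₀
      S₀≥1 = ℕ.≤-pred (ℕ.≤-trans (s≤s p≥1) (ℕ.≤-reflexive (sym (trans (card-delete (proj₁ s) x (∈⇒∋ (x∈s σ))) (card-vertex s)))))
      contra : (∃ λ x′ → S₀ ∋ x′) → ⊥
      contra (x′ , i) with ∋-delete⁻ (proj₁ s) x i
      ... | x′∈s , x′≢x
        with swap s (∋⇒∈ x′∈s) (y∉s σ) (λ a∈ nb → ⊥-elim (nnb (subst (λ a → Nbr a y) (swap-nbr σ a∈ nb) nb)))
      ...   | w′ , σ′ with un w′ (swap-≢ σ′) (swap-leq σ′ (Swap.y∈u σ))
      ...     | refl with from σ′ (x∈s σ)
      ...       | inj₁ e = x′≢x (sym e)
      ...       | inj₂ q = x∉u q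

  module _ (γ : Automorphism (suc p) k) where
    open Automorphism γ

    leq-pres : ∀ {s u w} → Leq s u w → Leq (fun s) (fun u) (fun w)
    leq-pres {s} {u} {w} le = ⇒leq λ r a b → subst (SGAdj (fun w)) (fun-inv r)
      (adj-pres w (inv r) (leq le (inv r)
        (adj-refl s (inv r) (subst (SGAdj (fun s)) (sym (fun-inv r)) a))
        (adj-refl u (inv r) (subst (SGAdj (fun u)) (sym (fun-inv r)) b))))

    fun-injective : ∀ {u v} → fun u ≡ fun v → u ≡ v
    fun-injective e = trans (sym (inv-fun _)) (trans (cong inv e) (inv-fun _))

  module _ (γ : Automorphism (suc p) k) where
    open Automorphism γ

    private
      leq-inv : ∀ {s u w} → Leq (fun s) (fun u) w → Leq s u (inv w)
      leq-inv {s} {u} {w} le = subst₂ (λ s u → Leq s u (inv w)) (inv-fun s) (inv-fun u)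
        (leq-pres (inverse γ) {fun s} {fun u} {w} le)

      leq-fun : ∀ {s u w} → Leq s (inv w) u → Leq (fun s) w (fun u)
      leq-fun {s} {u} {w} le = subst (λ w → Leq (fun s) w (fun u)) (fun-inv w)
        (leq-pres γ {s} {inv w} {u} le)

      inv-≢ : ∀ {s w} → w ≢ fun s → inv w ≢ s
      inv-≢ {s} {w} ne e = ne (trans (sym (fun-inv w)) (cong fun e))

    abstract
      near-pres : ∀ {s u} → Near s u → Near (fun s) (fun u)
      near-pres {s} {u} (ne , mx) = ne ∘ fun-injective γ , λ w w≢ le →
        leq-fun {s} {u} {w} (mx (inv w) (inv-≢ w≢) (leq-inv {s} {u} {w} le))

    abstract
      move-pres : ∀ {s u} → Move s u → Move (fun s) (fun u)
      move-pres {s} {u} (ne , un) = ne ∘ fun-injective γ , λ w w≢ le →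
        trans (sym (fun-inv w)) (cong fun (un (inv w) (inv-≢ w≢) (leq-inv {s} {u} {w} le)))

-- Rigidity and dihedral symmetries

opposite-fromℕ : ∀ l → opposite (fromℕ l) ≡ zero
opposite-fromℕ zero = refl
opposite-fromℕ (suc l) = cong inject₁ (opposite-fromℕ l)

opposite-inject₁ : ∀ {l} (i : Fin l) → opposite (inject₁ i) ≡ suc (opposite i)
opposite-inject₁ zero = refl
opposite-inject₁ (suc i) = cong inject₁ (opposite-inject₁ i)

opposite-next : ∀ {l} (x : Fin (suc l)) → opposite (next x) ≡ prev (opposite x)
opposite-next x with view x
... | ‵fromℕ = cong prev (sym (opposite-fromℕ _))
... | ‵inject₁ i = cong prev (sym (opposite-inject₁ i))

-- With offset 0 this is the sum of the elements, a measure that falls under left moves not crossing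
-- 0.
weight : ∀ {m} → ℕ → Vec Bool m → ℕ
weight o [] = 0
weight o (b ∷ S) = (if b then o else 0) + weight (suc o) S

weight-insert : ∀ {m} o (S : Vec Bool m) x → ¬ S ∋ x → weight o (S [ x ]≔ true) ≡ (o + toℕ x) + weight o S
weight-insert o (true ∷ S) zero n = ⊥-elim (n refl)
weight-insert o (false ∷ S) zero n = cong (_+ weight (suc o) S) (sym (ℕ.+-identityʳ o))
weight-insert o (b ∷ S) (suc x) n rewrite weight-insert (suc o) S x n = begin
  c + (suc o + toℕ x + w) ≡⟨ ℕ.+-assoc c _ w ⟨
  c + (suc o + toℕ x) + w ≡⟨ cong (_+ w) (ℕ.+-comm c _) ⟩
  suc o + toℕ x + c + w   ≡⟨ cong (λ a → a + c + w) (ℕ.+-suc o (toℕ x)) ⟨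
  o + suc (toℕ x) + c + w ≡⟨ ℕ.+-assoc _ c w ⟩
  o + suc (toℕ x) + (c + w) ∎
  where
  open ≡-Reasoning
  c = if b then o else 0
  w = weight (suc o) S

update-update-lookup : ∀ {m} (S : Vec Bool m) x → S ∋ x → (S [ x ]≔ false) [ x ]≔ true ≡ S
update-update-lookup (true ∷ S) zero e = refl
update-update-lookup (b ∷ S) (suc x) e = cong (b ∷_) (update-update-lookup S x e)

parity : ∀ a → ∃ λ d → a ≡ d + d ⊎ a ≡ d + d + 1
parity zero = 0 , inj₁ refl
parity (suc a) with parity a
... | d , inj₁ e = d , inj₂ (trans (cong suc e) (ℕ.+-comm 1 _))
... | d , inj₂ e = suc d , inj₁ (trans (cong suc (trans e (ℕ.+-comm _ 1))) (cong suc (sym (ℕ.+-suc d d))))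

identity : ∀ {n k} → Automorphism n k
identity = record
  { fun = λ v → v ; inv = λ v → v ; inv-fun = λ _ → refl ; fun-inv = λ _ → refl
  ; adj-pres = λ _ _ a → a ; adj-refl = λ _ _ a → a }

module Symmetries (p k : ℕ) (p≥1 : 1 ℕ.≤ p) (k≥1 : 1 ℕ.≤ k) where

  open Stable-Kneser p k p≥1 k≥1
  open Swap
  open _∈_

  swap-sym : ∀ {s u x y} → Swap s u x y → Swap u s y x
  swap-sym σ = record { x∈s = y∈u σ ; x∉u = y∉s σ ; y∈u = x∈s σ ; y∉s = x∉u σ ; to = from σ ; from = to σ }

  swap-removed : ∀ {s u x y x′ y′} → Swap s u x y → Swap s u x′ y′ → x ≡ x′
  swap-removed σ τ with from τ (x∈s σ)
  ... | inj₁ e = e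
  ... | inj₂ i = ⊥-elim (x∉u σ i)

  swap-added : ∀ {s u x y x′ y′} → Swap s u x y → Swap s u x′ y′ → y ≡ y′
  swap-added σ τ = swap-removed (swap-sym σ) (swap-sym τ)

  -- Here `b`, `x` lie only in `r` and `a`, `y` only in `p`; everything else is shared. A common
  -- swap consists of the shared part, one of `b`, `x` and one of `a`, `y`. The pairs `a`, `b` and
  -- `x`, `y` are adjacent and hence excluded; the other two give `s` and `q`.
  square : ∀ {s r p q a b x y v} → Swap s r a b → Swap s p x y → Swap r q x y → Nbr a b → Nbr x y →
    a ≢ x → b ≢ y → (∃ λ c → ∃ λ d → Swap r v c d) → (∃ λ c → ∃ λ d → Swap p v c d) → v ≡ s ⊎ v ≡ q
  square {s} {r} {p} {q} {a} {b} {x} {y} {v} σ τ ω nab nxy a≢x b≢y (c , d , α) (c′ , d′ , β) = go (from α (y∈u σ))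
    where
    b∉p : b ∉ p
    b∉p i with to τ i
    ... | inj₁ e = b≢y e
    ... | inj₂ j = y∉s σ j
    a∉r = x∉u σ
    y∉r = y∉s ω
    x∈r = x∈s ω
    a∈p : a ∈ p
    a∈p with from τ (x∈s σ)
    ... | inj₁ e = ⊥-elim (a≢x e)
    ... | inj₂ i = i
    -- Only one element of p is missing from v, so v contains a or y.
    added : (d ≡ a × a ∈ v) ⊎ (d ≡ y × y ∈ v)
    added with from β a∈p | from β (y∈u τ)
    ... | inj₂ i | _ = inj₁ (new (to α i) , i)
      where
      new : a ≡ d ⊎ a ∈ r → d ≡ a
      new (inj₁ e) = sym e
      new (inj₂ j) = ⊥-elim (a∉r j)
    ... | inj₁ _ | inj₂ i = inj₂ (new (to α i) , i)
      where
      new : y ≡ d ⊎ y ∈ r → d ≡ y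
      new (inj₁ e) = sym e
      new (inj₂ j) = ⊥-elim (y∉r j)
    ... | inj₁ e | inj₁ e′ = ⊥-elim (y∉s τ (subst (_∈ s) (trans e (sym e′)) (x∈s σ)))
    go : b ≡ c ⊎ b ∈ v → v ≡ s ⊎ v ≡ q
    go (inj₁ refl) with from α x∈r | added
    ... | inj₁ refl | _ = ⊥-elim (y∉s σ (x∈s τ))
    ... | inj₂ x∈v | inj₂ (_ , y∈v) = ⊥-elim (nonadjacent v nxy x∈v y∈v)
    ... | inj₂ _ | inj₁ (refl , _) = inj₁ (swap-unique α (swap-sym σ))
    go (inj₂ b∈v) with from α x∈r
    ... | inj₂ x∈v = ⊥-elim (y∉s σ (subst (_∈ s) (sym (trans (only b∈v b∉p) (sym (only x∈v (x∉u τ))))) (x∈s τ)))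
      where
      only : ∀ {z} → z ∈ v → z ∉ p → z ≡ d′
      only i n with to β i
      ... | inj₁ e = e
      ... | inj₂ j = ⊥-elim (n j)
    ... | inj₁ refl with added
    ...   | inj₁ (_ , a∈v) = ⊥-elim (nonadjacent v nab a∈v b∈v)
    ...   | inj₂ (refl , _) = inj₂ (swap-unique α ω)

  module Rigidity (γ : Automorphism (suc p) k) where
    open Automorphism γ

    Fixed : V → Set
    Fixed s = fun s ≡ s × (∀ u → Move s u → fun u ≡ u)

    module _ {s r : V} (fixed : Fixed s) {a b : Pos} (σ : Swap s r a b) (nab : Nbr a b) where

      -- A move of r at another element commutes with the move from a to b and so closes a square
      -- of fixed vertices, except if it goes to the position next to a.  The two remaining kinds of
      -- moves are told apart by Near s.
      data Kind (q : V) : Set where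
        is-fixed : fun q ≡ q → Kind q
        onward   : ∀ {y} → Swap r q b y → Nbr b y → y ≢ a → Near s q → Kind q
        follow   : ∀ {x y} → Swap r q x y → Nbr x y → Nbr a y → y ≢ b → x ≢ a → ¬ Near s q → Kind q

      fun-r : fun r ≡ r
      fun-r = proj₂ fixed r (step⇒move σ nab)

      kind : ∀ q → Move r q → Kind q
      kind q μ with move⇒step {r} {q} μ
      ... | x , y , ω , nxy with x Fin.≟ b | y Fin.≟ a
      ...   | yes refl | yes refl = is-fixed (subst (λ q → fun q ≡ q) (swap-unique (swap-sym σ) ω) (proj₁ fixed))
      ...   | yes refl | no y≢a = onward ω nxy y≢a (swap⇒near {x = a} {y = y} record
        { x∈s = x∈s σ
        ; x∉u = λ i → a∉q i
        ; y∈u = y∈u ω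
        ; y∉s = λ i → y∉s′ i
        ; to = to′
        ; from = from′ })
        where
        a∉q : a ∉ q
        a∉q i with to ω i
        ... | inj₁ e = y≢a (sym e)
        ... | inj₂ j = x∉u σ j
        y∉s′ : y ∉ s
        y∉s′ i with from σ i
        ... | inj₁ e = y≢a e
        ... | inj₂ j = y∉s ω j
        to′ : ∀ {z} → z ∈ q → z ≡ y ⊎ z ∈ s
        to′ i with to ω i
        ... | inj₁ e = inj₁ e
        ... | inj₂ j with to σ j
        ...   | inj₁ refl = ⊥-elim (x∉u ω i)
        ...   | inj₂ j′ = inj₂ j′
        from′ : ∀ {z} → z ∈ s → z ≡ a ⊎ z ∈ q
        from′ i with from σ i
        ... | inj₁ e = inj₁ e
        ... | inj₂ j with from ω j
        ...   | inj₁ refl = ⊥-elim (y∉s σ i)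
        ...   | inj₂ j′ = inj₂ j′
      ...   | no x≢b | y≟a = else (Nbr? a y)
        where
        x∈s′ : x ∈ s
        x∈s′ with to σ (x∈s ω)
        ... | inj₁ e = ⊥-elim (x≢b e)
        ... | inj₂ i = i
        x≢a : x ≢ a
        x≢a refl = x∉u σ (x∈s ω)
        y≢a : y ≢ a
        y≢a refl = nonadjacent s nxy x∈s′ (x∈s σ)
        y≢b : y ≢ b
        y≢b refl = y∉s ω (y∈u σ)
        y∉s′ : y ∉ s
        y∉s′ i with from σ i
        ... | inj₁ e = y≢a e
        ... | inj₂ j = y∉s ω j
        b∈q : b ∈ q
        b∈q with from ω (y∈u σ)
        ... | inj₁ e = ⊥-elim (x≢b (sym e))
        ... | inj₂ j = j
        else : Dec (Nbr a y) → Kind q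
        -- `q` contains both `b` and `y`, which are outside `s`, so no single swap leads from `s` to
        -- `q`.
        else (yes nay) = follow ω nxy nay y≢b x≢a λ near →
          let _ , _ , α = near⇒swap {s} {q} near in
          y≢b (trans (only α (y∈u ω) y∉s′) (sym (only α b∈q (y∉s σ))))
          where
          only : ∀ {c d z} → Swap s q c d → z ∈ q → z ∉ s → z ≡ d
          only α i n with to α i
          ... | inj₁ e = e
          ... | inj₂ j = ⊥-elim (n j)
        -- As `y` is not next to `a`, the move from `x` to `y` is already available at `s`. It leads
        -- to the fourth corner `v`, which is fixed, and `square` leaves only `s` and `q` for
        -- `fun q`.
        else (no ¬nay) with swap s x∈s′ y∉s′ (λ i nb → lone i nb (from σ i))
          where
          lone : ∀ {c} → c ∈ s → Nbr c y → c ≡ a ⊎ c ∈ r → c ≡ x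
          lone i nb (inj₁ refl) = ⊥-elim (¬nay nb)
          lone i nb (inj₂ j) = swap-nbr ω j nb
        ... | v , τ = is-fixed (result (square σ τ ω nab nxy (x≢a ∘ sym) (y≢b ∘ sym) near-r near-v))
          where
          fun-v : fun v ≡ v
          fun-v = proj₂ fixed v (step⇒move τ nxy)
          v-q : Swap v q a b
          v-q = record
            { x∈s = a∈v ; x∉u = a∉q ; y∈u = b∈q ; y∉s = b∉v ; to = to′ ; from = from′ }
            where
            a∈v : a ∈ v
            a∈v with from τ (x∈s σ)
            ... | inj₁ e = ⊥-elim (x≢a (sym e))
            ... | inj₂ i = i
            a∉q : a ∉ q
            a∉q i with to ω i
            ... | inj₁ e = y≢a (sym e)
            ... | inj₂ j = x∉u σ j
            b∉v : b ∉ v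
            b∉v i with to τ i
            ... | inj₁ e = y≢b (sym e)
            ... | inj₂ j = y∉s σ j
            to′ : ∀ {z} → z ∈ q → z ≡ b ⊎ z ∈ v
            to′ i with to ω i
            ... | inj₁ refl = inj₂ (y∈u τ)
            ... | inj₂ j with to σ j
            ...   | inj₁ e = inj₁ e
            ...   | inj₂ j′ with from τ j′
            ...     | inj₁ refl = ⊥-elim (x∉u ω i)
            ...     | inj₂ j″ = inj₂ j″
            from′ : ∀ {z} → z ∈ v → z ≡ a ⊎ z ∈ q
            from′ i with to τ i
            ... | inj₁ refl = inj₂ (y∈u ω)
            ... | inj₂ j with from σ j
            ...   | inj₁ e = inj₁ e
            ...   | inj₂ j′ with from ω j′
            ...     | inj₁ refl = ⊥-elim (x∉u τ i)
            ...     | inj₂ j″ = inj₂ j″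
          near-r : ∃ λ c → ∃ λ d → Swap r (fun q) c d
          near-r = near⇒swap {r} {fun q} (subst (λ r → Near r (fun q)) fun-r (near-pres γ {r} {q} (swap⇒near ω)))
          near-v : ∃ λ c → ∃ λ d → Swap v (fun q) c d
          near-v = near⇒swap {v} {fun q} (subst (λ v → Near v (fun q)) fun-v (near-pres γ {v} {q} (swap⇒near v-q)))
          result : fun q ≡ s ⊎ fun q ≡ q → fun q ≡ q
          result (inj₂ e) = e
          result (inj₁ e) = ⊥-elim (y∉s′ (subst (y ∈_) (fun-injective γ (trans e (sym (proj₁ fixed)))) (y∈u ω)))

      near-fun : ∀ {q} → Near s q → Near s (fun q)
      near-fun {q} ν = subst (λ s → Near s (fun q)) (proj₁ fixed) (near-pres γ {s} {q} ν)

      near-fun⁻ : ∀ {q} → Near s (fun q) → Near s q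
      near-fun⁻ {q} ν = subst₂ Near (trans (cong inv (sym (proj₁ fixed))) (inv-fun s)) (inv-fun q)
        (near-pres (inverse γ) {s} {fun q} ν)

      -- At most one vertex is `onward` and at most one is `follow`, since `other-neighbour`
      -- determines the positions one after the other.
      same-kind : ∀ {q} → Kind q → Kind (fun q) → fun q ≡ q
      same-kind (is-fixed e) _ = e
      same-kind _ (is-fixed e) = fun-injective γ e
      same-kind (onward ω nby y≢a _) (onward ω′ nby′ y′≢a _)
        with other-neighbour (Nbr-sym nab) nby nby′ y≢a y′≢a
      ... | refl = swap-unique ω′ ω
      same-kind (follow ω nxy nay y≢b x≢a _) (follow ω′ nxy′ nay′ y′≢b x′≢a _)
        with other-neighbour nab nay nay′ y≢b y′≢b
      ... | refl with other-neighbour (Nbr-sym nay) (Nbr-sym nxy) (Nbr-sym nxy′) x≢a x′≢a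
      ...   | refl = swap-unique ω′ ω
      same-kind {q} (onward _ _ _ ν) (follow _ _ _ _ _ ¬ν) = ⊥-elim (¬ν (near-fun {q} ν))
      same-kind {q} (follow _ _ _ _ _ ¬ν) (onward _ _ _ ν) = ⊥-elim (¬ν (near-fun⁻ {q} ν))

    rigid : ∀ {s r} → Fixed s → Move s r → Fixed r
    rigid {s} {r} fixed μ with move⇒step {s} {r} μ
    ... | a , b , σ , nab = proj₂ fixed r μ , λ q μ′ →
      same-kind fixed σ nab (kind fixed σ nab q μ′)
        (kind fixed σ nab (fun q) (subst (λ r → Move r (fun q)) (fun-r fixed σ nab) (move-pres γ {r} {q} μ′)))

  -- Left and right moves, and stuck vertices

  record StepLeft (s u : V) : Set where
    constructor step-left
    field {from-left} : Pos
          swap-left : Swap s u from-left (prev from-left)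

  record StepRight (s u : V) : Set where
    constructor step-right
    field {from-right} : Pos
          swap-right : Swap s u from-right (next from-right)

  move⇒left-or-right : ∀ {s u} → Move s u → StepLeft s u ⊎ StepRight s u
  move⇒left-or-right {s} {u} μ with move⇒step {s} {u} μ
  ... | x , y , σ , inj₁ refl = inj₂ (step-right σ)
  ... | x , y , σ , inj₂ refl = inj₁ (step-left (subst (Swap s u (next y)) (sym (prev-next y)) σ))

  left⇒move : ∀ {s u} → StepLeft s u → Move s u
  left⇒move (step-left {x} σ) = step⇒move σ (inj₂ (next-prev x))

  right⇒move : ∀ {s u} → StepRight s u → Move s u
  right⇒move (step-right {x} σ) = step⇒move σ (inj₁ refl)

  LeftMovable : V → Pos → Set
  LeftMovable s x = x ∈ s × prev (prev x) ∉ s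

  RightMovable : V → Pos → Set
  RightMovable s x = x ∈ s × next (next x) ∉ s

  abstract
    left-swap : ∀ {s x} → LeftMovable s x → ∃ λ u → Swap s u x (prev x)
    left-swap {s} {x} (i , n) = swap s i (nonadjacent s (inj₂ (next-prev x)) i) lone
      where
      lone : ∀ {a} → a ∈ s → Nbr a (prev x) → a ≡ x
      lone j (inj₁ e) = ⊥-elim (n (subst (_∈ s) (trans (sym (prev-next _)) (cong prev e)) j))
      lone j (inj₂ e) = trans (sym e) (next-prev x)

  abstract
    right-swap : ∀ {s x} → RightMovable s x → ∃ λ u → Swap s u x (next x)
    right-swap {s} {x} (i , n) = swap s i (stable′ s x i) lone
      where
      lone : ∀ {a} → a ∈ s → Nbr a (next x) → a ≡ x
      lone j (inj₁ e) = next-injective e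
      lone j (inj₂ e) = ⊥-elim (n (subst (_∈ s) (sym e) j))

  swap-left⇒movable : ∀ {s u x} → Swap s u x (prev x) → LeftMovable s x
  swap-left⇒movable {x = x} σ = x∈s σ , λ i →
    next²-≢ l≥2 (prev (prev x))
      (trans (cong next (next-prev _)) (trans (next-prev x) (sym (swap-nbr σ i (inj₁ (next-prev _))))))

  swap-right⇒movable : ∀ {s u x} → Swap s u x (next x) → RightMovable s x
  swap-right⇒movable {x = x} σ = x∈s σ , λ i → next²-≢ l≥2 x (swap-nbr σ i (inj₂ refl))

  private
    _≟_ : (u v : V) → Dec (u ≡ v)
    u ≟ v = map′ vertex-≡ (cong proj₁) (proj₁ u ≟V proj₁ v)

  -- No element other than 0 can move left.  For odd m this forces s = {0, 2, …, 2n − 2}.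
  Stuck : V → Set
  Stuck s = ∀ {x} → x ∈ s → x ≢ zero → prev (prev x) ∈ s

  swap-subset : ∀ {s u x y} → Swap s u x y → proj₁ u ≡ (proj₁ s [ x ]≔ false) [ y ]≔ true
  swap-subset {s} {u} {x} {y} σ = subset-ext (λ _ i → ⊆₁ (∋⇒∈ i) (to σ (∋⇒∈ i))) ⊆₂
    where
    S₀ = proj₁ s [ x ]≔ false
    ⊆₁ : ∀ {z} → z ∈ u → z ≡ y ⊎ z ∈ s → S₀ [ y ]≔ true ∋ z
    ⊆₁ i (inj₁ refl) = ∋-insert-same S₀ y
    ⊆₁ i (inj₂ (∋⇒∈ j)) = ∋-insert-other S₀ y (∋-delete (proj₁ s) x j λ { refl → x∉u σ i })
    ⊆₂ : S₀ [ y ]≔ true ⊆ proj₁ u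
    ⊆₂ z i with ∋-insert⁻ S₀ y i
    ... | inj₁ refl = ∈⇒∋ (y∈u σ)
    ... | inj₂ j with ∋-delete⁻ (proj₁ s) x j
    ...   | q , ne with from σ (∋⇒∈ q)
    ...     | inj₁ e = ⊥-elim (ne e)
    ...     | inj₂ r = ∈⇒∋ r

  swap-weight : ∀ {s u x y} → Swap s u x y → toℕ y ℕ.< toℕ x →
    weight 0 (proj₁ u) ℕ.< weight 0 (proj₁ s)
  swap-weight {s} {u} {x} {y} σ lt = begin-strict
    weight 0 (proj₁ u)              ≡⟨ cong (weight 0) (swap-subset σ) ⟩
    weight 0 (S₀ [ y ]≔ true)       ≡⟨ weight-insert 0 S₀ y (y∉s σ ∘ ∋⇒∈ ∘ proj₁ ∘ ∋-delete⁻ (proj₁ s) x) ⟩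
    toℕ y + weight 0 S₀             <⟨ ℕ.+-monoˡ-< (weight 0 S₀) lt ⟩
    toℕ x + weight 0 S₀             ≡⟨ weight-insert 0 S₀ x (∌-delete-same (proj₁ s) x) ⟨
    weight 0 (S₀ [ x ]≔ true)       ≡⟨ cong (weight 0) (update-update-lookup (proj₁ s) x (∈⇒∋ (x∈s σ))) ⟩
    weight 0 (proj₁ s)              ∎
    where
    open ℕ.≤-Reasoning
    S₀ = proj₁ s [ x ]≔ false

  prev-< : (x : Pos) → x ≢ zero → toℕ (prev x) ℕ.< toℕ x
  prev-< zero ne = ⊥-elim (ne refl)
  prev-< (suc x) ne = s≤s (ℕ.≤-reflexive (Fin.toℕ-inject₁ x))

  stuck-or-descends : ∀ s → Stuck s ⊎ ∃ λ u → Move u s × weight 0 (proj₁ u) ℕ.< weight 0 (proj₁ s)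
  stuck-or-descends s
    with Fin.any? (λ x → (x ∈? s) ×-dec ¬? (x Fin.≟ zero) ×-dec ¬? (prev (prev x) ∈? s))
  ... | no none = inj₁ λ {x} i ne → decidable-stable (prev (prev x) ∈? s) λ n → none (x , i , ne , n)
  ... | yes (x , i , ne , n) = let u , σ = left-swap (i , n) in
    inj₂ (u , step⇒move (swap-sym σ) (inj₁ (next-prev x)) , swap-weight σ (prev-< x ne))

  abstract
    -- A vertex that is not stuck has a left move not crossing 0, which lowers `weight`; so moves
    -- connect every vertex to a stuck one.
    move-induction : (P : V → Set) → (∀ {s} → Stuck s → P s) → (∀ {u s} → Move u s → P u → P s) → ∀ s → P s
    move-induction P base ind s = go s (<-wellFounded _)
      where
      go : ∀ s → Acc ℕ._<_ (weight 0 (proj₁ s)) → P s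
      go s (acc rec) with stuck-or-descends s
      ... | inj₁ st = base st
      ... | inj₂ (u , μ , lt) = ind {u} {s} μ (go u (rec lt))

  stuck-exists : V → ∃ Stuck
  stuck-exists = move-induction (λ _ → ∃ Stuck) (λ st → _ , st) (λ _ r → r)

  -- Rotations and the reflection as automorphisms

  permute : (f g : Pos → Pos) → (∀ x → f (g x) ≡ x) → (∀ x → g (f x) ≡ x) →
    (∀ x → Nbr (f x) (f (next x))) → V → V
  permute f g fg gf nb v = mk (tabulate (lookup (proj₁ v) ∘ f))
    (λ x i j → nonadjacent v (nb x) (∋⇒∈ (trans (sym (lookup∘tabulate (lookup (proj₁ v) ∘ f) x)) i))
                                    (∋⇒∈ (trans (sym (lookup∘tabulate (lookup (proj₁ v) ∘ f) (next x))) j)))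
    (trans (card-permute (proj₁ v) f g fg gf) (card-vertex v))

  -- The symmetric `Nbr` admits the reflection besides the rotations. Sets are pulled back along
  -- `f`, so elements move along `g`: shifting right has `f = prev`.
  record Permutation : Set where
    field
      f g : Pos → Pos
      fg : ∀ x → f (g x) ≡ x
      gf : ∀ x → g (f x) ≡ x
      f-nbr : ∀ x → Nbr (f x) (f (next x))
      g-nbr : ∀ x → Nbr (g x) (g (next x))

  module Permuted (π : Permutation) where
    open Permutation π

    abstract
      F G : V → V
      F = permute f g fg gf f-nbr
      G = permute g f gf fg g-nbr

      ∈F : ∀ {x v} → f x ∈ v → x ∈ F v
      ∈F {x} {v} (∋⇒∈ i) = ∋⇒∈ (trans (lookup∘tabulate (lookup (proj₁ v) ∘ f) x) i)

      ∈F⁻ : ∀ {x v} → x ∈ F v → f x ∈ v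
      ∈F⁻ {x} {v} (∋⇒∈ i) = ∋⇒∈ (trans (sym (lookup∘tabulate (lookup (proj₁ v) ∘ f) x)) i)

      ∈G⁻ : ∀ {x v} → x ∈ G v → g x ∈ v
      ∈G⁻ {x} {v} (∋⇒∈ i) = ∋⇒∈ (trans (sym (lookup∘tabulate (lookup (proj₁ v) ∘ g) x)) i)

    automorphism : Automorphism (suc p) k
    automorphism = record
      { fun = F ; inv = G
      ; inv-fun = λ v → ⊆⇒≡ λ {x} i → subst (_∈ v) (fg x) (∈F⁻ (∈G⁻ i))
      ; fun-inv = λ v → ⊆⇒≡ λ {x} i → subst (_∈ v) (gf x) (∈G⁻ (∈F⁻ i))
      ; adj-pres = λ u v a → adj⇐ {F u} {F v} λ i j → adj⇒ {u} {v} a (∈F⁻ i) (∈F⁻ j)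
      ; adj-refl = λ u v a → adj⇐ {u} {v} λ {x} i j → adj⇒ {F u} {F v} a
          (∈F {g x} (subst (_∈ u) (sym (fg x)) i)) (∈F {g x} (subst (_∈ v) (sym (fg x)) j)) }

    permute-swap : ∀ {s u x y} → Swap s u x y → Swap (F s) (F u) (g x) (g y)
    permute-swap {s} {u} {x} {y} σ = record
      { x∈s = ∈F (subst (_∈ s) (sym (fg x)) (x∈s σ))
      ; x∉u = λ i → x∉u σ (subst (_∈ u) (fg x) (∈F⁻ i))
      ; y∈u = ∈F (subst (_∈ u) (sym (fg y)) (y∈u σ))
      ; y∉s = λ i → y∉s σ (subst (_∈ s) (fg y) (∈F⁻ i))
      ; to = λ i → back (to σ (∈F⁻ i))
      ; from = λ i → back (from σ (∈F⁻ i)) }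
      where
      back : ∀ {v w z} → f z ≡ v ⊎ f z ∈ w → z ≡ g v ⊎ z ∈ F w
      back (inj₁ refl) = inj₁ (sym (gf _))
      back (inj₂ i) = inj₂ (∈F i)

  shift-right shift-left reflection : Permutation
  shift-right = record { f = prev ; g = next ; fg = prev-next ; gf = next-prev
    ; f-nbr = λ x → inj₁ (trans (next-prev x) (sym (prev-next x))) ; g-nbr = λ x → inj₁ refl }
  shift-left = record { f = next ; g = prev ; fg = next-prev ; gf = prev-next
    ; f-nbr = λ x → inj₁ refl ; g-nbr = λ x → inj₁ (trans (next-prev x) (sym (prev-next x))) }
  reflection = record { f = opposite ; g = opposite ; fg = Fin.opposite-involutive ; gf = Fin.opposite-involutive
    ; f-nbr = opp ; g-nbr = opp }
    where
    opp : ∀ x → Nbr (opposite x) (opposite (next x))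
    opp x = inj₂ (trans (cong next (opposite-next x)) (next-prev _))

  module Shiftʳ = Permuted shift-right
  module Shiftˡ = Permuted shift-left
  module Reflect = Permuted reflection

  data Dihedral : Automorphism (suc p) k → Set where
    dihedral-id : Dihedral identity
    dihedral-shift : Dihedral Shiftˡ.automorphism
    dihedral-reflect : Dihedral Reflect.automorphism
    dihedral-∘ : ∀ {γ δ} → Dihedral γ → Dihedral δ → Dihedral (compose γ δ)

  reflect-right : ∀ {s u} → StepRight s u →
    StepLeft (Reflect.F s) (Reflect.F u)
  reflect-right {s} {u} (step-right {x} σ) =
    step-left (subst (Swap _ _ (opposite x)) (opposite-next x) (Reflect.permute-swap σ))

  abstract
    -- Comparing `s` with its translate gives `t` with `prev t ∈ s` and, by freeness, `next t ∉ s`;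
    -- so `prev t` can move right.
    right-movable : ∀ s → ∃ (RightMovable s)
    right-movable s with free-difference {s} {Shiftʳ.F s} ne
      where
      ne : s ≢ Shiftʳ.F s
      ne e = let x , i = card-pos (proj₁ s) (ℕ.≤-trans (s≤s z≤n) (ℕ.≤-reflexive (sym (card-vertex s)))) in
        stable′ s x (∋⇒∈ i) (subst (next x ∈_) (sym e) (Shiftʳ.∈F (subst (_∈ s) (sym (prev-next x)) (∋⇒∈ i))))
    ... | t , t∈ , t∉ , free = prev t , Shiftʳ.∈F⁻ t∈ , λ i →
      free (subst (λ t → next t ∈ s) (next-prev t) i , Shiftʳ.∈F⁻ t∈)

  abstract
    left-movable : ∀ s → ∃ (LeftMovable s)
    left-movable s with free-difference {s} {Shiftˡ.F s} ne
      where
      ne : s ≢ Shiftˡ.F s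
      ne e = let x , i = card-pos (proj₁ s) (ℕ.≤-trans (s≤s z≤n) (ℕ.≤-reflexive (sym (card-vertex s)))) in
        nonadjacent s (inj₁ (next-prev x))
          (subst (prev x ∈_) (sym e) (Shiftˡ.∈F (subst (_∈ s) (sym (next-prev x)) (∋⇒∈ i)))) (∋⇒∈ i)
    ... | t , t∈ , t∉ , free = next t , Shiftˡ.∈F⁻ t∈ , λ i →
      free (Shiftˡ.∈F⁻ t∈ , subst (λ t → prev t ∈ s) (prev-next t) i)

  -- Reduction to dihedral symmetries when m is odd

  module _ {e : ℕ} (l≡2e : l ≡ e + e) where

    stuck-descends : ∀ {s} → Stuck s → ∀ d {x y} → toℕ y ≡ d + d + toℕ x → y ∈ s → x ∈ s
    stuck-descends {s} st zero eq i = subst (_∈ s) (Fin.toℕ-injective eq) i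
    stuck-descends {s} st (suc d) {x} {y} eq i =
      stuck-descends st d (toℕ-prev (prev y) (toℕ-prev y eq′))
        (st i λ { refl → ℕ.0≢1+n eq′ })
      where
      eq′ : toℕ y ≡ suc (suc (d + d + toℕ x))
      eq′ = trans eq (cong (λ a → suc (a + toℕ x)) (ℕ.+-suc d d))

    toℕ-next-zero : toℕ (next (zero {l})) ≡ 1
    toℕ-next-zero = toℕ-next zero (ℕ.≤-trans (s≤s z≤n) l≥2)

    -- An odd element would descend in steps of two to 1, then past 0 to position `l`, which is even
    -- because m is odd, and from there to 0; but 0 and 1 are adjacent.
    stuck-even : ∀ {s} → Stuck s → ∀ {y} → y ∈ s → ∃ λ d → toℕ y ≡ d + d
    stuck-even {s} st {y} i with parity (toℕ y)
    ... | d , inj₁ eq = d , eq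
    ... | d , inj₂ eq = ⊥-elim (stable′ s zero 0∈s 1∈s)
      where
      1∈s : next zero ∈ s
      1∈s = stuck-descends st d (trans eq (cong (d + d +_) (sym toℕ-next-zero))) i
      0∈s : zero ∈ s
      0∈s = stuck-descends st e (trans (Fin.toℕ-fromℕ l) (trans l≡2e (sym (ℕ.+-identityʳ _))))
        (subst (λ x → prev x ∈ s) (prev-next zero) (st 1∈s (next-≢ l≥2 zero)))

    private
      gap : ∀ {i j} → i ℕ.≤ j → j + j ≡ (j ℕ.∸ i) + (j ℕ.∸ i) + (i + i)
      gap {i} {j} le = begin
        j + j                     ≡⟨ cong₂ _+_ (ℕ.m∸n+n≡m le) (ℕ.m∸n+n≡m le) ⟨
        (d + i) + (d + i)         ≡⟨ ℕ.+-assoc d i (d + i) ⟩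
        d + (i + (d + i))         ≡⟨ cong (d +_) (ℕ.+-comm i (d + i)) ⟩
        d + (d + i + i)           ≡⟨ cong (d +_) (ℕ.+-assoc d i i) ⟩
        d + (d + (i + i))         ≡⟨ ℕ.+-assoc d d (i + i) ⟨
        d + d + (i + i)           ∎
        where
        open ≡-Reasoning
        d = j ℕ.∸ i

    stuck-lower : ∀ {s} → Stuck s → ∀ {x y i j} → toℕ x ≡ i + i → toℕ y ≡ j + j → i ℕ.≤ j → y ∈ s → x ∈ s
    stuck-lower st {i = i} {j} ex ey le =
      stuck-descends st (j ℕ.∸ i) (trans ey (trans (gap le) (cong ((j ℕ.∸ i) + (j ℕ.∸ i) +_) (sym ex))))

    -- Stuck sets are initial segments of the even numbers, so two of them are nested, and equal
    -- cardinality decides.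
    stuck-unique : ∀ {s u} → Stuck s → Stuck u → s ≡ u
    stuck-unique {s} {u} st su with s ≟ u
    ... | yes eq = eq
    ... | no ne with missing ne
    ...   | x , x∈s , x∉u = sym (⊆⇒≡ λ {y} y∈u → sub y∈u)
      where
      sub : ∀ {y} → y ∈ u → y ∈ s
      sub y∈u with stuck-even st x∈s | stuck-even su y∈u
      ... | i , ex | j , ey with ℕ.≤-total i j
      ...   | inj₁ le = ⊥-elim (x∉u (stuck-lower su ex ey le y∈u))
      ...   | inj₂ le = stuck-lower st ey ex le x∈s

    stuck-left-unique : ∀ {s u w} → Stuck s → StepLeft s u → StepLeft s w → u ≡ w
    stuck-left-unique {s} st (step-left σ) (step-left τ)
      with at-zero σ | at-zero τ
      where
      at-zero : ∀ {v x} → Swap s v x (prev x) → x ≡ zero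
      at-zero {x = x} σ with x Fin.≟ zero
      ... | yes eq = eq
      ... | no ne = let i , n = swap-left⇒movable σ in ⊥-elim (n (st i ne))
    ... | refl | refl = swap-unique σ τ

    stuck-below : ∀ {s} → Stuck s → ∀ {x y i j} → toℕ x ≡ i + i → toℕ y ≡ j + j → i ℕ.< j →
      y ∈ s → next (next x) ∈ s
    stuck-below st {x} {y} {i} {j} ex ey lt = stuck-lower st {i = suc i} ex″ ey lt
      where
      y≤l : j + j ℕ.≤ l
      y≤l = subst (ℕ._≤ l) ey (Fin.toℕ≤pred[n] y)
      room : suc (suc (i + i)) ℕ.≤ l
      room = ℕ.≤-trans (ℕ.≤-reflexive (cong suc (sym (ℕ.+-suc i i)))) (ℕ.≤-trans (ℕ.+-mono-≤ lt lt) y≤l)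
      ex′ : toℕ (next x) ≡ suc (i + i)
      ex′ = trans (toℕ-next x (subst (ℕ._< l) (sym ex) (ℕ.<-trans (ℕ.n<1+n _) room))) (cong suc ex)
      ex″ : toℕ (next (next x)) ≡ suc i + suc i
      ex″ = trans (toℕ-next (next x) (subst (ℕ._< l) (sym ex′) room))
              (trans (cong suc ex′) (cong suc (sym (ℕ.+-suc i i))))

    -- Only the largest element can move right: by `stuck-below`, the position two after any smaller
    -- one is occupied.
    stuck-right-unique : ∀ {s u w} → Stuck s → StepRight s u → StepRight s w → u ≡ w
    stuck-right-unique {s} st (step-right {x} σ) (step-right {y} τ)
      with swap-right⇒movable σ | swap-right⇒movable τ
    ... | x∈ , x″∉ | y∈ , y″∉ with stuck-even st x∈ | stuck-even st y∈
    ...   | i , ex | j , ey with ℕ.<-cmp i j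
    ...     | tri< lt _ _ = ⊥-elim (x″∉ (stuck-below st ex ey lt y∈))
    ...     | tri> _ _ lt = ⊥-elim (y″∉ (stuck-below st ey ex lt x∈))
    ...     | tri≈ _ refl _ with Fin.toℕ-injective (trans ex (sym ey))
    ...       | refl = swap-unique σ τ

    -- Preserving left steps records that `δ` keeps the orientation, which `undo-reflected` relies
    -- on.
    Straightens : Automorphism (suc p) k → V → Set
    Straightens δ s = let open Automorphism δ in
      Dihedral δ × Stuck (fun s) × (∀ {u w} → StepLeft u w → StepLeft (fun u) (fun w))

    RotatesToStuck : Pos → Set
    RotatesToStuck y = ∀ s → (∀ {x} → LeftMovable s x → x ≡ y) → ∃ λ δ → Straightens δ s

    abstract
      -- For `y = zero` the hypothesis says that `s` is already stuck; a left shift reduces the case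
      -- of `next y` to that of `y`.
      rotate-to-stuck : ∀ y → RotatesToStuck y
      rotate-to-stuck = cycle-induction RotatesToStuck shift {zero}
        (λ s h → identity , dihedral-id ,
          (λ {x} i ne → decidable-stable (prev (prev x) ∈? s) λ n → ne (h (i , n))) , λ st → st)
        where
        shift-steps : ∀ {u w} → StepLeft u w →
          StepLeft (Shiftˡ.F u) (Shiftˡ.F w)
        shift-steps (step-left {x} σ) = step-left (Shiftˡ.permute-swap σ)
        shift : ∀ y → RotatesToStuck y → RotatesToStuck (next y)
        shift y ih s h =
          let δ , d , st , pres = ih (Shiftˡ.F s) λ {x} (i , n) →
                next-injective (h (Shiftˡ.∈F⁻ i , λ j → n (Shiftˡ.∈F (subst (_∈ s)
                  (trans (cong prev (prev-next x)) (sym (next-prev (prev x)))) j))))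
          in compose δ Shiftˡ.automorphism , dihedral-∘ d dihedral-shift , st , pres ∘ shift-steps

    abstract
      left-step-exists : ∀ s → ∃ (StepLeft s)
      left-step-exists s = let x , m = left-movable s ; u , σ = left-swap m in u , step-left σ

    abstract
      right-step-exists : ∀ s → ∃ (StepRight s)
      right-step-exists s = let x , m = right-movable s ; u , σ = right-swap m in u , step-right σ

    module _ {B X Y : V} (B-stuck : Stuck B) (B-left : StepLeft B X) (B-right : StepRight B Y) where

      B-moves : ∀ {u} → Move B u → u ≡ X ⊎ u ≡ Y
      B-moves {u} μ with move⇒left-or-right {B} {u} μ
      ... | inj₁ st = inj₁ (stuck-left-unique B-stuck st B-left)
      ... | inj₂ st = inj₂ (stuck-right-unique B-stuck st B-right)

      left≢right : ∀ {s u w} → StepLeft s u → StepRight s w → u ≢ w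
      left≢right (step-left {x} σ) (step-right {y} τ) refl with swap-removed σ τ
      ... | refl = next²-≢ l≥2 (prev x) (trans (cong next (next-prev x)) (sym (swap-added σ τ)))

      module _ (γ : Automorphism (suc p) k) where
        open Automorphism γ

        image-moves : ∀ u → Move (fun B) u → u ≡ fun X ⊎ u ≡ fun Y
        image-moves u μ with B-moves {inv u} (subst (λ s → Move s (inv u)) (inv-fun B) (move-pres (inverse γ) {fun B} {u} μ))
        ... | inj₁ e = inj₁ (trans (sym (fun-inv u)) (cong fun e))
        ... | inj₂ e = inj₂ (trans (sym (fun-inv u)) (cong fun e))

        -- `fun B` has only the moves `fun X` and `fun Y`. One of them is the right step `v`, so the
        -- two left steps are the same.
        pigeonhole : ∀ {s u w v x y} → Swap s u x (prev x) → Swap s w y (prev y) → StepRight s v →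
          u ≡ fun X ⊎ u ≡ fun Y → w ≡ fun X ⊎ w ≡ fun Y → v ≡ fun X ⊎ v ≡ fun Y → x ≡ y
        pigeonhole σ τ ω (inj₁ refl) (inj₁ refl) _ = swap-removed σ τ
        pigeonhole σ τ ω (inj₂ refl) (inj₂ refl) _ = swap-removed σ τ
        pigeonhole σ τ ω (inj₁ a) (inj₂ _) (inj₁ c) = ⊥-elim (left≢right (step-left σ) ω (trans a (sym c)))
        pigeonhole σ τ ω (inj₁ _) (inj₂ b) (inj₂ c) = ⊥-elim (left≢right (step-left τ) ω (trans b (sym c)))
        pigeonhole σ τ ω (inj₂ _) (inj₁ b) (inj₁ c) = ⊥-elim (left≢right (step-left τ) ω (trans b (sym c)))
        pigeonhole σ τ ω (inj₂ a) (inj₁ _) (inj₂ c) = ⊥-elim (left≢right (step-left σ) ω (trans a (sym c)))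

        image-left-unique : ∀ {x y} → LeftMovable (fun B) x → LeftMovable (fun B) y → x ≡ y
        image-left-unique mx my with left-swap mx | left-swap my | right-step-exists (fun B)
        ... | u , σ | w , τ | v , ω = pigeonhole σ τ ω
          (image-moves u (left⇒move (step-left σ))) (image-moves w (left⇒move (step-left τ)))
          (image-moves v (right⇒move ω))

      abstract
        straighten : (γ : Automorphism (suc p) k) → ∃ λ δ → let open Automorphism δ in
          Dihedral δ × fun (Automorphism.fun γ B) ≡ B × (∀ {u w} → StepLeft u w → StepLeft (fun u) (fun w))
        straighten γ with left-movable (Automorphism.fun γ B)
        ... | y , my with rotate-to-stuck y (Automorphism.fun γ B) (λ mx → image-left-unique γ mx my)
        ...   | δ , d , st , pres = δ , d , stuck-unique st B-stuck , pres

      -- `B` has no moves besides `X` and `Y`, so `Y` is fixed too; from `B`, the only stuck vertex,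
      -- rigidity spreads to every vertex.
      fixing-X : (γ : Automorphism (suc p) k) → let open Automorphism γ in
        fun B ≡ B → fun X ≡ X → ∀ v → fun v ≡ v
      fixing-X γ fB fX v = proj₁ (move-induction Fixed base (λ {u} {s} μ f → rigid {u} {s} f μ) v)
        where
        open Automorphism γ
        open Rigidity γ
        fY : fun Y ≡ Y
        fY with B-moves {fun Y} (subst (λ s → Move s (fun Y)) fB (move-pres γ {B} {Y} (right⇒move B-right)))
        ... | inj₂ e = e
        ... | inj₁ e = ⊥-elim (left≢right B-left B-right
                         (fun-injective γ (trans fX (sym e))))
        base : ∀ {s} → Stuck s → Fixed s
        base {s} st with stuck-unique st B-stuck
        ... | refl = fB , λ u μ → moved u (B-moves {u} μ)
          where
          moved : ∀ u → u ≡ X ⊎ u ≡ Y → fun u ≡ u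
          moved u (inj₁ refl) = fX
          moved u (inj₂ refl) = fY

      Undoes : Automorphism (suc p) k → Automorphism (suc p) k → Set
      Undoes δ γ = Dihedral δ × (∀ v → Automorphism.fun δ (Automorphism.fun γ v) ≡ v)

      -- The reflection turns the right step from `fun B` to `fun X` into a left step. Once the
      -- rotation has brought its source back to `B`, it can only end in `X`.
      undo-reflected : (γ : Automorphism (suc p) k) → let open Automorphism γ in
        fun B ≡ B → fun X ≡ Y → ∃ λ δ → Undoes δ γ
      undo-reflected γ fB fX with straighten (compose Reflect.automorphism γ)
      ... | δ , d , fB′ , pres = compose δ Reflect.automorphism , dihedral-∘ d dihedral-reflect ,
        fixing-X (compose δ (compose Reflect.automorphism γ)) fB′
          (stuck-left-unique B-stuck
            (subst (λ s → StepLeft s (Automorphism.fun δ (Reflect.F (fun X)))) fB′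
              (pres (reflect-right (subst₂ StepRight (sym fB) (sym fX) B-right))))
            B-left)
        where open Automorphism γ

      undo : (γ : Automorphism (suc p) k) → ∃ λ δ → Undoes δ γ
      undo γ with straighten γ
      ... | δ , d , fB , _ = by-orientation (B-moves {fun δ (fun γ X)}
          (subst (λ s → Move s (fun δ (fun γ X))) fB (move-pres (compose δ γ) {B} {X} (left⇒move B-left))))
        where
        open Automorphism
        by-orientation : fun δ (fun γ X) ≡ X ⊎ fun δ (fun γ X) ≡ Y → ∃ λ δ → Undoes δ γ
        by-orientation (inj₁ fX) = δ , d , fixing-X (compose δ γ) fB fX
        by-orientation (inj₂ fX) = let ε , e , h = undo-reflected (compose δ γ) fB fX in
          compose ε δ , dihedral-∘ e d , h

    undo-automorphism : V → (γ : Automorphism (suc p) k) → ∃ λ δ → Dihedral δ ×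
      (∀ v → Automorphism.fun δ (Automorphism.fun γ v) ≡ v)
    undo-automorphism v γ =
      let B , st = stuck-exists v
          X , left = left-step-exists B
          Y , right = right-step-exists B
      in undo st left right γ

-- Even permutations of the colours

-- t i exchanges the adjacent colours i and i + 1 (and is the identity if i + 1 ≥ K).
t : ∀ {K} → ℕ → Fin K → Fin K
t {suc zero} zero x = x
t {suc (suc K)} zero zero = suc zero
t {suc (suc K)} zero (suc zero) = zero
t {suc (suc K)} zero (suc (suc x)) = suc (suc x)
t (suc i) zero = zero
t (suc i) (suc x) = suc (t i x)

t-involutive : ∀ {K} i (x : Fin K) → t i (t i x) ≡ x
t-involutive {suc zero} zero x = refl
t-involutive {suc (suc K)} zero zero = refl
t-involutive {suc (suc K)} zero (suc zero) = refl
t-involutive {suc (suc K)} zero (suc (suc x)) = refl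
t-involutive (suc i) zero = refl
t-involutive (suc i) (suc x) = cong suc (t-involutive i x)

t-injective : ∀ {K} i {x y : Fin K} → t i x ≡ t i y → x ≡ y
t-injective i {x} {y} e = trans (sym (t-involutive i x)) (trans (cong (t i) e) (t-involutive i y))

t-fromℕ : ∀ {l} i → suc i ℕ.< l → t i (fromℕ l) ≡ fromℕ l
t-fromℕ zero (s≤s (s≤s _)) = refl
t-fromℕ (suc i) (s≤s lt) = cong suc (t-fromℕ i lt)

t-inject₁ : ∀ {l} i (x : Fin l) → suc i ℕ.< l → t i (inject₁ x) ≡ inject₁ (t i x)
t-inject₁ zero zero (s≤s (s≤s _)) = refl
t-inject₁ zero (suc zero) (s≤s (s≤s _)) = refl
t-inject₁ zero (suc (suc x)) (s≤s (s≤s _)) = refl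
t-inject₁ (suc i) zero _ = refl
t-inject₁ (suc i) (suc x) (s≤s lt) = cong suc (t-inject₁ i x lt)

prev-t : ∀ {l} i (x : Fin (suc l)) → suc i ℕ.< l → prev (t (suc i) x) ≡ t i (prev x)
prev-t i zero lt = sym (t-fromℕ i lt)
prev-t i (suc x) lt = sym (t-inject₁ i x lt)

act : ∀ {K} → List ℕ → Fin K → Fin K
act [] x = x
act (i ∷ w) x = t i (act w x)

act-++ : ∀ {K} w w′ (x : Fin K) → act (w ++ w′) x ≡ act w (act w′ x)
act-++ [] w′ x = refl
act-++ (i ∷ w) w′ x = cong (t i) (act-++ w w′ x)

act-map-suc-zero : ∀ {K} w → act (map suc w) (zero {K}) ≡ zero
act-map-suc-zero [] = refl
act-map-suc-zero (i ∷ w) = cong (t (suc i)) (act-map-suc-zero w)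

act-map-suc : ∀ {K} w (x : Fin K) → act (map suc w) (suc x) ≡ suc (act w x)
act-map-suc [] x = refl
act-map-suc (i ∷ w) x = cong (t (suc i)) (act-map-suc w x)

-- The last letter acts first: `prev` exchanges 0 and 1 and then cycles the colours from 1 on;
-- `opposite` reverses the colours from 1 on and then applies `prev`.
prev-word opposite-word : ℕ → List ℕ
prev-word zero = []
prev-word (suc l) = map suc (prev-word l) ++ 0 ∷ []
opposite-word zero = []
opposite-word (suc l) = prev-word (suc l) ++ map suc (opposite-word l)

act-prev-word : ∀ l (x : Fin (suc l)) → act (prev-word l) x ≡ prev x
act-prev-word zero zero = refl
act-prev-word (suc l) x = trans (act-++ (map suc (prev-word l)) (0 ∷ []) x) (go x)
  where
  go : ∀ x → act (map suc (prev-word l)) (t 0 x) ≡ prev x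
  go zero = trans (act-map-suc (prev-word l) zero) (cong suc (act-prev-word l zero))
  go (suc zero) = act-map-suc-zero (prev-word l)
  go (suc (suc x)) = trans (act-map-suc (prev-word l) (suc x)) (cong suc (act-prev-word l (suc x)))

act-opposite-word : ∀ l (x : Fin (suc l)) → act (opposite-word l) x ≡ opposite x
act-opposite-word zero zero = refl
act-opposite-word (suc l) x = trans (act-++ (prev-word (suc l)) (map suc (opposite-word l)) x)
  (trans (act-prev-word (suc l) _) (go x))
  where
  go : ∀ x → prev (act (map suc (opposite-word l)) x) ≡ opposite x
  go zero = cong prev (act-map-suc-zero (opposite-word l))
  go (suc x) = trans (cong prev (act-map-suc (opposite-word l) x)) (cong inject₁ (act-opposite-word l x))

prev-word-< : ∀ l → All (ℕ._< l) (prev-word l)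
prev-word-< zero = []
prev-word-< (suc l) = All.++⁺ (All.map⁺ (All.map s≤s (prev-word-< l))) (s≤s z≤n ∷ [])

opposite-word-< : ∀ l → All (ℕ._< l) (opposite-word l)
opposite-word-< zero = []
opposite-word-< (suc l) = All.++⁺ (prev-word-< (suc l)) (All.map⁺ (All.map s≤s (opposite-word-< l)))

odd : List ℕ → Bool
odd [] = false
odd (_ ∷ w) = not (odd w)

odd-++ : ∀ w w′ → odd (w ++ w′) ≡ odd w xor odd w′
odd-++ [] w′ = refl
odd-++ (_ ∷ w) w′ = trans (cong not (odd-++ w w′)) (Bool.not-distribˡ-xor (odd w) (odd w′))

odd-map : ∀ w → odd (map suc w) ≡ odd w
odd-map [] = refl
odd-map (_ ∷ w) = cong not (odd-map w)

odd-prev-word : ∀ l → odd (prev-word (suc l)) ≡ not (odd (prev-word l))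
odd-prev-word l = trans (odd-++ (map suc (prev-word l)) (0 ∷ []))
  (trans (cong (_xor true) (odd-map (prev-word l))) (Bool.xor-comm _ true))

odd-opposite-word : ∀ l → odd (opposite-word (suc l)) ≡ not (odd (prev-word l)) xor odd (opposite-word l)
odd-opposite-word l = trans (odd-++ (prev-word (suc l)) (map suc (opposite-word l)))
  (cong₂ _xor_ (odd-prev-word l) (odd-map (opposite-word l)))

-- The lengths are l and l(l + 1)/2, whose parities have period 4.
words-4-periodic : ∀ l → odd (prev-word (4 + l)) ≡ odd (prev-word l) ×
  odd (opposite-word (4 + l)) ≡ odd (opposite-word l)
words-4-periodic l
  rewrite odd-opposite-word (3 + l) | odd-opposite-word (2 + l) | odd-opposite-word (1 + l) | odd-opposite-word l
        | odd-prev-word (3 + l) | odd-prev-word (2 + l) | odd-prev-word (1 + l) | odd-prev-word l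
  with odd (prev-word l) | odd (opposite-word l)
... | true | true = refl , refl
... | true | false = refl , refl
... | false | true = refl , refl
... | false | false = refl , refl

words-even : ∀ q → odd (prev-word (2 + (q * 4 + 2))) ≡ false × odd (opposite-word (2 + (q * 4 + 2))) ≡ false
words-even zero = refl , refl
words-even (suc q) with words-4-periodic (2 + (q * 4 + 2)) | words-even q
... | e₁ , e₂ | e₃ , e₄ = trans e₁ e₃ , trans e₂ e₄

opposite-injective : ∀ {m} {x y : Fin m} → opposite x ≡ opposite y → x ≡ y
opposite-injective {x = x} {y} e =
  trans (sym (Fin.opposite-involutive x)) (trans (cong opposite e) (Fin.opposite-involutive y))

-- The graph parameter is `suc k`, so there are k + 3 colours and `t k ∘ t (suc k)` is the 3-cycle
-- of the top three.
module Recolouring {n k : ℕ} (c : Coloring n (suc k)) (ρ : Automorphism n (suc k))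
  (shift-path : HomPath c (prev ∘ c ∘ Automorphism.fun ρ))
  (base : HomPath c (t k ∘ t (suc k) ∘ c)) where

  l : ℕ
  l = k + 2

  t-path : ∀ i {f g : Coloring n (suc k)} → HomPath f g → HomPath (t i ∘ f) (t i ∘ g)
  t-path i = path-recolor (t i) (t-injective i)

  -- Conjugation by prev lowers the index of an adjacent transposition.
  three-cycle-step : ∀ i → suc (suc i) ℕ.< l → HomPath c (t (suc i) ∘ t (suc (suc i)) ∘ c) →
    HomPath c (t i ∘ t (suc i) ∘ c)
  three-cycle-step i lt p =
    path-trans shift-path
      (path-trans
        (path-respʳ (λ v → trans (prev-t i (t (suc (suc i)) (c (Automorphism.fun ρ v))) (ℕ.<-trans (ℕ.n<1+n _) lt))
            (cong (t i) (prev-t (suc i) (c (Automorphism.fun ρ v)) lt)))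
          (path-precompose ρ (path-recolor prev prev-injective p)))
        (t-path i (t-path (suc i) (path-sym shift-path))))

  three-cycle : ∀ d i → i + d ≡ k → HomPath c (t i ∘ t (suc i) ∘ c)
  three-cycle zero i e = subst (λ k → HomPath c (t k ∘ t (suc k) ∘ c)) (trans (sym e) (ℕ.+-identityʳ i)) base
  three-cycle (suc d) i e = three-cycle-step i
    (ℕ.≤-trans (s≤s (s≤s (s≤s (ℕ.m≤m+n i d)))) (ℕ.≤-reflexive (trans (cong (2 +_) e′) (ℕ.+-comm 2 k))))
    (three-cycle d (suc i) e′)
    where
    e′ : suc i + d ≡ k
    e′ = trans (sym (ℕ.+-suc i d)) e

  -- Applying the involution `t i` to the path from `c` to `t i ∘ t (suc i) ∘ c` joins `t i ∘ c` to
  -- `t (suc i) ∘ c`.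
  transposition-path : ∀ i → i ℕ.< l → HomPath (t 0 ∘ c) (t i ∘ c)
  transposition-path zero lt = done (λ u v a p → path-source base u v a (t-injective 0 p)) λ _ → refl
  transposition-path (suc i) lt = path-trans (transposition-path i (ℕ.<-trans (ℕ.n<1+n i) lt))
    (path-respʳ (λ v → t-involutive i _)
      (t-path i (three-cycle (k ℕ.∸ i) i (ℕ.m+[n∸m]≡n i≤k))))
    where
    i≤k : i ℕ.≤ k
    i≤k = ℕ.≤-pred (ℕ.≤-pred (ℕ.≤-trans lt (ℕ.≤-reflexive (ℕ.+-comm k 2))))

  -- Up to paths every letter can be replaced by `t 0`, so letters cancel in pairs.
  word-path : ∀ w → All (ℕ._< l) w → HomPath (act w ∘ c) ((if odd w then t 0 else λ x → x) ∘ c)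
  word-path [] [] = done (path-source base) λ _ → refl
  word-path (i ∷ w) (lt ∷ lts) with odd w | word-path w lts
  ... | false | p = path-trans (t-path i p) (path-sym (transposition-path i lt))
  ... | true | p = path-respʳ (λ v → t-involutive i _)
        (t-path i (path-trans p (transposition-path i lt)))

  even-path : ∀ w → All (ℕ._< l) w → odd w ≡ false → HomPath (act w ∘ c) c
  even-path w lts e = subst (λ b → HomPath (act w ∘ c) ((if b then t 0 else λ x → x) ∘ c)) e (word-path w lts)

-- The canonical colouring

noAdj-tail : ∀ {m} a (S : Vec Bool m) → T (noAdj (a ∷ S)) → T (noAdj S)
noAdj-tail a [] h = _
noAdj-tail a (b ∷ S) h = proj₂ (∧-split (not (a ∧ b)) h)

noAdj-head : ∀ {m} b (S : Vec Bool m) → T (noAdj (true ∷ b ∷ S)) → b ≡ false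
noAdj-head false S h = refl

Below : ∀ {m} → ℕ → Vec Bool m → Set
Below e S = ∀ x → S ∋ x → toℕ x ℕ.< e

below-zero : ∀ {m} (S : Vec Bool m) → Below 0 S → card S ≡ 0
below-zero S h with card S in e
... | zero = refl
... | suc _ with card-pos S (ℕ.≤-trans (s≤s z≤n) (ℕ.≤-reflexive (sym e)))
...   | x , i with () ← h x i

below-tail : ∀ {m e b} {S : Vec Bool m} → Below (suc e) (b ∷ S) → Below e S
below-tail h x i = ℕ.≤-pred (h (suc x) i)

-- Each element takes two places with the empty one after it, except that the last may sit at the
-- end; hence the `suc`. The variant with an empty first position saves this one.
double-card : ∀ {m} e (S : Vec Bool m) → T (noAdj S) → Below e S → card S + card S ℕ.≤ suc e
double-card-false : ∀ {m} e (S : Vec Bool m) → T (noAdj S) → Below e (false ∷ S) → card S + card S ℕ.≤ e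

double-card-false zero S h b = ℕ.≤-reflexive (cong₂ _+_ z z)
  where z = below-zero (false ∷ S) b
double-card-false (suc e) S h b = double-card e S h (below-tail {S = S} b)

double-card e [] h b = z≤n
double-card e (false ∷ S) h b = ℕ.m≤n⇒m≤1+n (double-card-false e S (noAdj-tail false S h) b)
double-card e (true ∷ S) h b with b zero refl
double-card (suc e) (true ∷ []) h b | _ = s≤s (s≤s z≤n)
double-card (suc e) (true ∷ a ∷ S) h b | _ with noAdj-head a S h
... | refl = s≤s (ℕ.≤-trans (ℕ.≤-reflexive (ℕ.+-suc (card S) (card S)))
  (s≤s (double-card-false e S (noAdj-tail false S (noAdj-tail true (false ∷ S) h))
    (below-tail {S = false ∷ S} b))))

double-card+min : ∀ {m} e (S : Vec Bool m) → T (noAdj S) → Below e S → 1 ℕ.≤ card S →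
  card S + card S + minIdx S ℕ.≤ suc e
double-card+min zero (false ∷ S) h b pos = ⊥-elim (ℕ.<⇒≢ pos (sym (below-zero (false ∷ S) b)))
double-card+min (suc e) (false ∷ S) h b pos = ℕ.≤-trans (ℕ.≤-reflexive (ℕ.+-suc _ (minIdx S)))
  (s≤s (double-card+min e S (noAdj-tail false S h) (below-tail {S = S} b) pos))
double-card+min e (true ∷ S) h b pos =
  ℕ.≤-trans (ℕ.≤-reflexive (ℕ.+-identityʳ _)) (double-card e (true ∷ S) h b)

minIdx-∋ : ∀ {m} (S : Vec Bool m) → 1 ℕ.≤ card S → ∃ λ x → S ∋ x × toℕ x ≡ minIdx S
minIdx-∋ (true ∷ S) pos = zero , refl , refl
minIdx-∋ (false ∷ S) pos = let x , i , e = minIdx-∋ S pos in suc x , i , cong suc e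

minIdx-≤ : ∀ {m} (S : Vec Bool m) x → S ∋ x → minIdx S ℕ.≤ toℕ x
minIdx-≤ (true ∷ S) x i = z≤n
minIdx-≤ (false ∷ S) (suc x) i = s≤s (minIdx-≤ S x i)

module Canonical (p k : ℕ) (p≥1 : 1 ℕ.≤ p) where

  open Stable-Kneser p (suc k) p≥1 (s≤s z≤n)
  open Symmetries p (suc k) p≥1 (s≤s z≤n)
  open _∈_

  c : Coloring (suc p) (suc k)
  c = canonical {suc p} {suc k}

  nonempty : (v : V) → 1 ℕ.≤ card (proj₁ v)
  nonempty v = ℕ.≤-trans (s≤s z≤n) (ℕ.≤-reflexive (sym (card-vertex v)))

  min-bound : (v : V) → ∀ e → Below e (proj₁ v) → suc p + suc p + minIdx (proj₁ v) ℕ.≤ suc e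
  min-bound v e b = subst (λ a → a + a + minIdx (proj₁ v) ℕ.≤ suc e) (card-vertex v)
    (double-card+min e (proj₁ v) noadj b (nonempty v))
    where
    noadj = proj₁ (∧-split (noAdj (proj₁ v)) (proj₁ (∧-split (stableB (proj₁ v)) (proj₂ v))))

  private
    m≡ : ∀ a b → suc (suc p + (suc p + 0) + suc a) + b ≡ (suc p + suc p) + (a + 2 + b)
    m≡ a b = trans (cong (λ z → suc (suc p + z + suc a) + b) (ℕ.+-identityʳ (suc p)))
      (trans (cong (_+ b) (trans (sym (ℕ.+-suc (suc p + suc p) (suc a)))
               (cong (suc p + suc p +_) (ℕ.+-comm 2 a))))
             (ℕ.+-assoc (suc p + suc p) (a + 2) b))

  min-< : (v : V) → minIdx (proj₁ v) ℕ.< suc k + 2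
  min-< v = s≤s (ℕ.+-cancelˡ-≤ (suc p + suc p) _ _ (ℕ.≤-trans (min-bound v (suc l) (λ x _ → Fin.toℕ<n x))
    (ℕ.≤-reflexive (trans (sym (ℕ.+-identityʳ _)) (trans (m≡ k 0) (cong (suc p + suc p +_) (ℕ.+-identityʳ _)))))))

  toℕ-c : (v : V) → toℕ (c v) ≡ minIdx (proj₁ v)
  toℕ-c v with minIdx (proj₁ v) <? suc k + 2
  ... | yes q = Fin.toℕ-fromℕ< q
  ... | no nq = ⊥-elim (nq (min-< v))

  c-∈ : (v : V) → ∃ λ x → x ∈ v × toℕ x ≡ toℕ (c v)
  c-∈ v = let x , i , e = minIdx-∋ (proj₁ v) (nonempty v) in x , ∋⇒∈ i , trans e (sym (toℕ-c v))

  c-≤ : (v : V) → ∀ {x} → x ∈ v → toℕ (c v) ℕ.≤ toℕ x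
  c-≤ v {x} (∋⇒∈ i) = ℕ.≤-trans (ℕ.≤-reflexive (toℕ-c v)) (minIdx-≤ (proj₁ v) x i)

  c-hom : IsHom c
  c-hom u v a e =
    let x , i , e₁ = c-∈ u
        y , j , e₂ = c-∈ v
    in adj⇒ {u} {v} a i (subst (_∈ v) (Fin.toℕ-injective (trans e₂ (trans (cong toℕ (sym e)) (sym e₁)))) j)

  -- If the translate contains 0, `prev` gives the top colour; otherwise its minimum less one is an
  -- element of `v`.
  c-shift : ∀ v → c v Fin.≤ prev (c (Shiftʳ.F v))
  c-shift v with c (Shiftʳ.F v) | c-∈ (Shiftʳ.F v)
  ... | zero | _ = ℕ.≤-trans (Fin.toℕ≤pred[n] (c v)) (ℕ.≤-reflexive (sym (Fin.toℕ-fromℕ _)))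
  ... | suc z | x , i , e = ℕ.≤-trans (c-≤ v (Shiftʳ.∈F⁻ i))
    (ℕ.≤-reflexive (trans (toℕ-prev x e) (sym (Fin.toℕ-inject₁ z))))

  -- The minimum of the reflected set is the distance from the maximum of `v` to the last position.
  -- As `v` spans at least 2n - 1 positions, the two minima add up to at most m - (2n - 1), the top
  -- colour.
  c-reflect : ∀ v → c v Fin.≤ opposite (c (Reflect.F v))
  c-reflect v = subst (toℕ (c v) ℕ.≤_) (sym (Fin.opposite-prop (c (Reflect.F v))))
    (ℕ.m+n≤o⇒m≤o∸n (toℕ (c v)) sum≤)
    where
    e = suc l ℕ.∸ toℕ (c (Reflect.F v))
    below : Below e (proj₁ v)
    below x i = ℕ.m+n≤o⇒m≤o∸n (suc (toℕ x)) (ℕ.≤-trans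
      (ℕ.+-monoʳ-≤ (suc (toℕ x)) (c-≤ (Reflect.F v) (Reflect.∈F {opposite x}
         (subst (_∈ v) (sym (Fin.opposite-involutive x)) (∋⇒∈ i)))))
      (ℕ.≤-reflexive (trans (cong (suc (toℕ x) +_) (Fin.opposite-prop x)) (ℕ.m+[n∸m]≡n (Fin.toℕ<n x)))))
    sum≤ : toℕ (c v) + suc (toℕ (c (Reflect.F v))) ℕ.≤ suc k + 2
    sum≤ = ℕ.≤-trans (ℕ.≤-reflexive (ℕ.+-suc _ _)) (s≤s (ℕ.+-cancelˡ-≤ (suc p + suc p) _ _ (begin
      (suc p + suc p) + (a + b)      ≡⟨ ℕ.+-assoc (suc p + suc p) a b ⟨
      (suc p + suc p) + a + b        ≤⟨ ℕ.+-monoˡ-≤ b (subst (λ a → suc p + suc p + a ℕ.≤ suc e)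
                                        (sym (toℕ-c v)) (min-bound v e below)) ⟩
      suc (suc l ℕ.∸ b) + b          ≡⟨ cong suc (ℕ.m∸n+n≡m b≤m) ⟩
      suc (suc l)                    ≡⟨ ℕ.+-identityʳ _ ⟨
      suc (suc l) + 0                ≡⟨ m≡ k 0 ⟩
      (suc p + suc p) + (k + 2 + 0)  ≡⟨ cong (suc p + suc p +_) (ℕ.+-identityʳ (k + 2)) ⟩
      (suc p + suc p) + (k + 2)      ∎)))
      where
      open ℕ.≤-Reasoning
      a = toℕ (c v)
      b = toℕ (c (Reflect.F v))
      b≤m : b ℕ.≤ suc l
      b≤m = let x , _ , e = c-∈ (Reflect.F v) in
        ℕ.≤-trans (ℕ.≤-reflexive (sym e)) (ℕ.<⇒≤ (Fin.toℕ<n x))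

  shift-path : HomPath c (prev ∘ c ∘ Shiftʳ.F)
  shift-path = ≤-path c-hom
    (λ u v a q → c-hom (Shiftʳ.F u) (Shiftʳ.F v)
      (Automorphism.adj-pres Shiftʳ.automorphism u v a) (prev-injective q))
    c-shift

  reflect-path : HomPath c (opposite ∘ c ∘ Reflect.F)
  reflect-path = ≤-path c-hom
    (λ u v a q → c-hom (Reflect.F u) (Reflect.F v)
      (Automorphism.adj-pres Reflect.automorphism u v a) (opposite-injective q))
    c-reflect

-- Rotating the top three colours

-- The value is meaningful only on windows satisfying `window-valid`, where the wildcards do not
-- affect the two least elements.
first-two : Vec Bool 5 → Fin 6
first-two (true ∷ _ ∷ true ∷ _ ∷ _ ∷ []) = 0F
first-two (true ∷ _ ∷ false ∷ true ∷ _ ∷ []) = 1F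
first-two (true ∷ _ ∷ false ∷ false ∷ _ ∷ []) = 2F
first-two (false ∷ true ∷ _ ∷ true ∷ _ ∷ []) = 3F
first-two (false ∷ true ∷ _ ∷ false ∷ _ ∷ []) = 4F
first-two (false ∷ false ∷ _ ∷ _ ∷ _ ∷ []) = 5F

-- The stable sets of a path on 5 points with at least two elements, coloured according to their
-- two least elements 02, 03, 04, 13, 14, 24.  Consecutive colourings differ on an independent
-- set; the first is the minimum and the last is its composite with the 3-cycle 0 ↦ 1 ↦ 2 ↦ 0.
window-colours : Fin 6 → Vec (Fin 3) 6
window-colours 0F = 0F ∷ 0F ∷ 0F ∷ 1F ∷ 1F ∷ 2F ∷ []
window-colours 1F = 0F ∷ 0F ∷ 0F ∷ 1F ∷ 2F ∷ 2F ∷ []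
window-colours 2F = 0F ∷ 1F ∷ 0F ∷ 1F ∷ 2F ∷ 2F ∷ []
window-colours 3F = 0F ∷ 1F ∷ 0F ∷ 1F ∷ 2F ∷ 0F ∷ []
window-colours 4F = 0F ∷ 1F ∷ 0F ∷ 2F ∷ 2F ∷ 0F ∷ []
window-colours 5F = 1F ∷ 1F ∷ 1F ∷ 2F ∷ 2F ∷ 0F ∷ []

window-colour : Fin 6 → Vec Bool 5 → Fin 3
window-colour i b = lookup (window-colours i) (first-two b)

window-valid : Vec Bool 5 → Bool
window-valid b = noAdj b ∧ (2 ≤ᵇ card b)

Separates : Fin 6 → Fin 6 → Vec Bool 5 → Vec Bool 5 → Set
Separates i j a b = T (window-valid a ∧ window-valid b ∧ disjointB a b) → window-colour i a ≢ window-colour j b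

separates? : ∀ i j → Dec (All (λ a → All (Separates i j a) (allSubsets 5)) (allSubsets 5))
separates? i j = All.all? (λ a → All.all? (λ b →
  Bool.T? _ →-dec ¬? (window-colour i a Fin.≟ window-colour j b)) _) _

data Consecutive : Fin 6 → Fin 6 → Set where
  same : ∀ {i j} → i ≡ j → Consecutive i j
  successive : ∀ {i j} a → i ≡ inject₁ a → j ≡ suc a → Consecutive i j

separates : ∀ {i j} → Consecutive i j → ∀ a b → Separates i j a b
separates {i} {j} s a b = All.lookup (All.lookup (table s) (∈-allSubsets a)) (∈-allSubsets b)
  where
  table : ∀ {i j} → Consecutive i j → All (λ a → All (Separates i j a) (allSubsets 5)) (allSubsets 5)
  table (same {0F} refl) = toWitness {a? = separates? 0F 0F} _
  table (same {1F} refl) = toWitness {a? = separates? 1F 1F} _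
  table (same {2F} refl) = toWitness {a? = separates? 2F 2F} _
  table (same {3F} refl) = toWitness {a? = separates? 3F 3F} _
  table (same {4F} refl) = toWitness {a? = separates? 4F 4F} _
  table (same {5F} refl) = toWitness {a? = separates? 5F 5F} _
  table (successive 0F refl refl) = toWitness {a? = separates? 0F 1F} _
  table (successive 1F refl refl) = toWitness {a? = separates? 1F 2F} _
  table (successive 2F refl refl) = toWitness {a? = separates? 2F 3F} _
  table (successive 3F refl refl) = toWitness {a? = separates? 3F 4F} _
  table (successive 4F refl refl) = toWitness {a? = separates? 4F 5F} _

rotates : ∀ b → T (window-valid b) → window-colour 5F b ≡ t 0 (t 1 (window-colour 0F b))
rotates b _ with first-two b
... | 0F = refl
... | 1F = refl
... | 2F = refl
... | 3F = refl
... | 4F = refl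
... | 5F = refl

prefix : ∀ {m} j → Vec Bool m → Vec Bool j
prefix zero S = []
prefix (suc j) [] = false ∷ prefix j []
prefix (suc j) (a ∷ S) = a ∷ prefix j S

prefix-disjoint : ∀ {m} j (S S′ : Vec Bool m) → T (disjointB S S′) → T (disjointB (prefix j S) (prefix j S′))
prefix-disjoint zero S S′ d = _
prefix-disjoint (suc j) [] [] d = prefix-disjoint j [] [] d
prefix-disjoint (suc j) (a ∷ S) (b ∷ S′) d with ∧-split (not (a ∧ b)) d
... | q , r = ∧-pair q (prefix-disjoint j S S′ r)

-- min S if it is less than j, and otherwise a colour read off from the five positions j, …, j + 4.
window-colouring : ∀ {m} → Fin 6 → ∀ j → Vec Bool m → Fin (suc j + 2)
window-colouring i zero S = window-colour i (prefix 5 S)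
window-colouring i (suc j) [] = zero
window-colouring i (suc j) (true ∷ S) = zero
window-colouring i (suc j) (false ∷ S) = suc (window-colouring i j S)

Spread : ∀ {m} → ℕ → Vec Bool m → Set
Spread {m} j S = T (noAdj S) × 2 ℕ.≤ card S × m ≡ card S + card S + suc j

spread-tail : ∀ {m j} {S : Vec Bool m} → Spread (suc j) (false ∷ S) → Spread j S
spread-tail {S = S} (h , c≥2 , e) = noAdj-tail false S h , c≥2 , ℕ.suc-injective (trans e (ℕ.+-suc _ _))

noAdj-prefix : ∀ {m} j (S : Vec Bool m) → j ℕ.≤ m → T (noAdj S) → T (noAdj (prefix j S))
noAdj-prefix zero S _ h = _
noAdj-prefix (suc zero) (a ∷ S) _ h = _
noAdj-prefix (suc (suc j)) (a ∷ b ∷ S) (s≤s le) h with ∧-split (not (a ∧ b)) h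
... | q , r = ∧-pair q (noAdj-prefix (suc j) (b ∷ S) le r)

noAdj-drop : ∀ {m} j (S : Vec Bool (j + m)) → T (noAdj S) → T (noAdj (Vec.drop j S))
noAdj-drop zero S h = h
noAdj-drop (suc j) (a ∷ S) h = noAdj-drop j S (noAdj-tail a S h)

card-prefix-drop : ∀ {m} j (S : Vec Bool (j + m)) → card S ≡ card (prefix j S) + card (Vec.drop j S)
card-prefix-drop zero S = refl
card-prefix-drop (suc j) (true ∷ S) = cong suc (card-prefix-drop j S)
card-prefix-drop (suc j) (false ∷ S) = card-prefix-drop j S

spread-length : ∀ {m} (S : Vec Bool m) → Spread 0 S → ∃ λ r → 5 + r ≡ m
spread-length S (h , c≥2 , e) =
  ℕ.m≤n⇒∃[o]m+o≡n (ℕ.≤-trans (ℕ.+-monoˡ-≤ 1 (ℕ.+-mono-≤ c≥2 c≥2)) (ℕ.≤-reflexive (sym e)))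

-- The r positions after the window hold at most (r + 1)/2 elements, while the length 5 + r is twice
-- the cardinality plus one; so at least two elements fall into the window.
spread-valid : ∀ {m} (S : Vec Bool m) → Spread 0 S → T (window-valid (prefix 5 S))
spread-valid {m} S g@(h , c≥2 , e) with spread-length S g
... | r , refl = ∧-pair (noAdj-prefix 5 S (ℕ.m≤m+n 5 r) h) (ℕ.≤⇒≤ᵇ (ℕ.≮⇒≥ card-P≮2))
  where
  cP = card (prefix 5 S)
  cR = card (Vec.drop 5 S)
  card-P≮2 : ¬ cP ℕ.< 2
  card-P≮2 (s≤s cP≤1) = ℕ.<-irrefl refl (begin-strict
    4 + r                          <⟨ ℕ.≤-refl ⟩
    5 + r                          ≡⟨ e ⟩
    card S + card S + 1            ≡⟨ cong (λ a → a + a + 1) (card-prefix-drop 5 S) ⟩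
    (cP + cR) + (cP + cR) + 1      ≤⟨ ℕ.+-monoˡ-≤ 1 (ℕ.+-mono-≤ (ℕ.+-monoˡ-≤ cR cP≤1) (ℕ.+-monoˡ-≤ cR cP≤1)) ⟩
    suc (cR + suc cR) + 1          ≡⟨ cong (λ a → suc a + 1) (ℕ.+-suc cR cR) ⟩
    suc (suc (cR + cR)) + 1        ≤⟨ s≤s (s≤s (ℕ.+-monoˡ-≤ 1 (double-card r (Vec.drop 5 S)
                                        (noAdj-drop 5 S h) (λ x _ → Fin.toℕ<n x)))) ⟩
    suc (suc (suc r)) + 1          ≡⟨ ℕ.+-comm _ 1 ⟩
    4 + r                          ∎)
    where open ℕ.≤-Reasoning

window-colouring-compatible : ∀ {m i i′} → Consecutive i i′ → ∀ j (S S′ : Vec Bool m) →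
  Spread j S → Spread j S′ → T (disjointB S S′) → window-colouring i j S ≢ window-colouring i′ j S′
window-colouring-compatible cons zero S S′ g g′ d =
  separates cons (prefix 5 S) (prefix 5 S′)
    (∧-pair (spread-valid S g) (∧-pair (spread-valid S′ g′) (prefix-disjoint 5 S S′ d)))
window-colouring-compatible cons (suc j) [] S′ (_ , () , _) g′ d
window-colouring-compatible cons (suc j) (true ∷ S) (true ∷ S′) g g′ () e
window-colouring-compatible cons (suc j) (true ∷ S) (false ∷ S′) g g′ d ()
window-colouring-compatible cons (suc j) (false ∷ S) (true ∷ S′) g g′ d ()
window-colouring-compatible cons (suc j) (false ∷ S) (false ∷ S′) g g′ d e =
  window-colouring-compatible cons j S S′ (spread-tail {S = S} g) (spread-tail {S = S′} g′) d (Fin.suc-injective e)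

window-colouring-last : ∀ {m} j (S : Vec Bool m) → Spread j S →
  window-colouring 5F j S ≡ t j (t (suc j) (window-colouring 0F j S))
window-colouring-last zero S g = rotates (prefix 5 S) (spread-valid S g)
window-colouring-last (suc j) [] g = refl
window-colouring-last (suc j) (true ∷ S) g = refl
window-colouring-last (suc j) (false ∷ S) g = cong suc (window-colouring-last j S (spread-tail {S = S} g))

window-colouring-first : ∀ {m} j (S : Vec Bool m) → Spread j S → toℕ (window-colouring 0F j S) ≡ minIdx S
window-colouring-first zero S g with spread-length S g
... | r , refl = go S (spread-valid S g)
  where
  go : (S : Vec Bool (5 + r)) → T (window-valid (prefix 5 S)) → toℕ (window-colour 0F (prefix 5 S)) ≡ minIdx S
  go (true ∷ a ∷ true ∷ b ∷ d ∷ S) v = refl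
  go (true ∷ a ∷ false ∷ true ∷ b ∷ S) v = refl
  go (true ∷ a ∷ false ∷ false ∷ b ∷ S) v = refl
  go (false ∷ true ∷ a ∷ true ∷ b ∷ S) v = refl
  go (false ∷ true ∷ a ∷ false ∷ b ∷ S) v = refl
  go (false ∷ false ∷ true ∷ a ∷ b ∷ S) v = refl
  go (false ∷ false ∷ false ∷ true ∷ true ∷ S) ()
  go (false ∷ false ∷ false ∷ true ∷ false ∷ S) ()
  go (false ∷ false ∷ false ∷ false ∷ true ∷ S) ()
  go (false ∷ false ∷ false ∷ false ∷ false ∷ S) ()
window-colouring-first (suc j) [] (_ , () , _)
window-colouring-first (suc j) (true ∷ S) g = refl
window-colouring-first (suc j) (false ∷ S) g = cong suc (window-colouring-first j S (spread-tail {S = S} g))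

module Paths (p k : ℕ) (p≥1 : 1 ℕ.≤ p) where

  open Stable-Kneser p (suc k) p≥1 (s≤s z≤n)
  open Symmetries p (suc k) p≥1 (s≤s z≤n)
  open Canonical p k p≥1

  spread : (v : V) → Spread k (proj₁ v)
  spread v = proj₁ (∧-split (noAdj (proj₁ v)) (proj₁ (∧-split (stableB (proj₁ v)) (proj₂ v)))) ,
    ℕ.≤-trans (s≤s p≥1) (ℕ.≤-reflexive (sym (card-vertex v))) ,
    trans (cong (λ a → suc p + a + suc k) (ℕ.+-identityʳ (suc p)))
      (cong (λ a → a + a + suc k) (sym (card-vertex v)))

  window : Fin 6 → Coloring (suc p) (suc k)
  window i v = window-colouring i k (proj₁ v)

  window-compatible : ∀ {i j} → Consecutive i j → ∀ u v → SGAdj u v → window i u ≢ window j v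
  window-compatible s u v a = window-colouring-compatible s k (proj₁ u) (proj₁ v) (spread u) (spread v) a

  window-step : ∀ i → HomPath (window (inject₁ i)) (window (suc i))
  window-step i = switching-path (window-compatible (same refl)) (window-compatible (same refl))
    (window-compatible (successive i refl refl))

  three-cycle-path : HomPath c (t k ∘ t (suc k) ∘ c)
  three-cycle-path = path-respˡ first (path-respʳ last
    (path-trans (window-step 0F) (path-trans (window-step 1F) (path-trans (window-step 2F)
      (path-trans (window-step 3F) (window-step 4F))))))
    where
    first : ∀ v → c v ≡ window 0F v
    first v = Fin.toℕ-injective (trans (toℕ-c v) (sym (window-colouring-first k (proj₁ v) (spread v))))
    last : ∀ v → window 5F v ≡ t k (t (suc k) (c v))
    last v = trans (window-colouring-last k (proj₁ v) (spread v)) (cong (t k ∘ t (suc k)) (sym (first v)))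

  open Recolouring {suc p} {k} c Shiftʳ.automorphism shift-path three-cycle-path using (even-path)

  module _ (prev-even : odd (prev-word (k + 2)) ≡ false)
           (opposite-even : odd (opposite-word (k + 2)) ≡ false) where

    prev-path : HomPath (prev ∘ c) c
    prev-path = path-respˡ (λ v → sym (act-prev-word (k + 2) (c v)))
      (even-path (prev-word (k + 2)) (prev-word-< (k + 2)) prev-even)

    opposite-path : HomPath (opposite ∘ c) c
    opposite-path = path-respˡ (λ v → sym (act-opposite-word (k + 2) (c v)))
      (even-path (opposite-word (k + 2)) (opposite-word-< (k + 2)) opposite-even)

    dihedral-path : ∀ {δ} → Dihedral δ → HomPath c (c ∘ Automorphism.fun δ)
    dihedral-path dihedral-id = done c-hom λ _ → refl
    -- The paths at hand join `c` to `c ∘ Shiftʳ.F`; precomposing with the left shift joins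
    -- `c ∘ Shiftˡ.F` to `c`.
    dihedral-path dihedral-shift = path-sym (path-respʳ (λ v → cong c (unshift v))
      (path-precompose Shiftˡ.automorphism
        (path-trans shift-path (path-precompose Shiftʳ.automorphism prev-path))))
      where
      unshift : ∀ v → Shiftʳ.F (Shiftˡ.F v) ≡ v
      unshift v = ⊆⇒≡ λ {x} i → subst (_∈ v) (next-prev x) (Shiftˡ.∈F⁻ (Shiftʳ.∈F⁻ i))
    dihedral-path dihedral-reflect =
      path-trans reflect-path (path-precompose Reflect.automorphism opposite-path)
    dihedral-path (dihedral-∘ {γ} {δ} d e) =
      path-trans (dihedral-path e) (path-precompose δ (dihedral-path d))

    automorphism-path : ∀ {e} → l ≡ e + e → (γ : Automorphism (suc p) (suc k)) →
      HomPath c (c ∘ Automorphism.fun γ)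
    automorphism-path {e} l≡2e γ with vertex-or-none
      where
      -- A search decides whether there is a vertex to descend from, so that the stuck vertex does
      -- not have to be written down.
      vertex-or-none : V ⊎ (V → ⊥)
      vertex-or-none with Any.any? (λ S → Bool.T? (stableB S ∧ (card S ≡ᵇ suc p))) (allSubsets _)
      ... | yes a = inj₁ (Any.lookup a , lookup-result a)
      ... | no none = inj₂ λ v → none (lose (∈-allSubsets (proj₁ v)) (proj₂ v))
    ... | inj₂ none = done c-hom λ v → ⊥-elim (none v)
    ... | inj₁ v = let δ , d , undone = undo-automorphism {e} l≡2e v γ in
      path-sym (path-respʳ (λ v → cong c (undone v)) (path-precompose γ (dihedral-path d)))

theorem4p3 : (n k : ℕ) → k % 4 ≡ 3 → 2 ≤ n → (γ : Automorphism n k) →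
    HomPath {n} {k} canonical (canonical ∘ Automorphism.fun γ)
theorem4p3 (suc p) k k%4≡3 (s≤s p≥1) γ with k ℕ./ 4 | m≡m%n+[m/n]*n k 4
... | q | k≡ with trans k≡ (cong (_+ q * 4) k%4≡3)
...   | refl = Paths.automorphism-path p (2 + q * 4) p≥1 (proj₁ (words-even q)) (proj₂ (words-even q))
        {p + 2 + q * 2} half γ
  where
  -- The left side is m - 1, which is even because k = 3 + 4q is odd.
  half : p + (suc p + 0) + (3 + q * 4) ≡ (p + 2 + q * 2) + (p + 2 + q * 2)
  half = solve 2 (λ p q → p :+ (con 1 :+ p :+ con 0) :+ (con 3 :+ q :* con 4)
    := (p :+ con 2 :+ q :* con 2) :+ (p :+ con 2 :+ q :* con 2)) refl p q
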